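{- Let $\Delta\ne0$ be some integer. Then for $X>0$ $$\sum_{\substack{r_1\\ (r_1,\Delta)=1}}\ \sum_{\substack{r_2\\ (r_2,\Delta)=1}}\ \sum_{\substack{d_1\\ q\mid d_1\Rightarrow q\mid\Delta}}\ \sum_{\substack{d_2\\ q\mid d_2\Rightarrow q\mid\Delta\\ [r_1^2d_1,r_2^2d_2]\le X}}1\le c(\Delta)\,\sqrt X\,\log^2X,$$ where $c(\Delta)$ is a constant depending only on $\Delta$.
   Context: $r_1,r_2,d_1,d_2$ run over positive integers; $q$ denotes primes, so "$q\mid d\Rightarrow q\mid\Delta$" means that every prime factor of $d$ divides $\Delta$. $(\cdot,\cdot)$ is the greatest common divisor and $[\cdot,\cdot]$ the least common multiple. $\log^2X=(\log X)^2$.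
   Formalization: The bound is proved for 0 < X < 1 and X ≥ 2 only; the range 1 ≤ X < 2 is excluded because at X = 1 the sum is at least 1 while √X log²X = 0, and for any fixed c(Δ) the bound also fails just above 1. -}

module Defs where

open import Data.Integer.Base as ℤ using (ℤ; +_; 1ℤ)
open import Data.Integer.Divisibility using () renaming (_∣_ to _∣ᶻ_)
open import Data.Integer.GCD using (gcd)
open import Data.List.Base using (List; length)
open import Data.List.Relation.Unary.All using (All)
open import Data.List.Relation.Unary.Unique.Propositional using (Unique)
open import Data.Nat.Base as ℕ using (ℕ; zero; suc; _⊔_; _!)
open import Data.Nat.Divisibility using (_∣_)
open import Data.Nat.LCM using (lcm)
open import Data.Nat.Primality using (Prime)
import Data.Nat.Properties as ℕₚ
open import Data.Product.Base using (∃-syntax; _×_; _,_)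
open import Data.Rational.Base as ℚ
  using (ℚ; 0ℚ; 1ℚ; ½; ∣_∣; _/_; 1/_; _+_; _*_; _-_; _≤_; _<_)
import Data.Rational.Properties as ℚₚ
open import Data.Rational.Solver using (module +-*-Solver)
open import Relation.Binary.PropositionalEquality
  using (_≡_; refl; sym; trans; cong; cong₂; subst)
open +-*-Solver using (solve; _:+_; _:*_; _:-_; _:=_)

------------------------------------------------------------------------
-- Real numbers: Cauchy sequences of rationals, considered up to _≈ᴿ_

Cauchy : (ℕ → ℚ) → Set
Cauchy x = ∀ ε → 0ℚ < ε →
  ∃[ N ] (∀ m n → N ℕ.≤ m → N ℕ.≤ n → ∣ x m - x n ∣ ≤ ε)

record ℝ : Set where
  constructor mkℝ
  field
    seq    : ℕ → ℚ
    cauchy : Cauchy seq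
open ℝ public

private
  open ℚₚ.≤-Reasoning

  split : ∀ a b → a ≡ b + (a - b)
  split = solve 2 (λ a b → a := b :+ (a :- b)) refl

  +-diff : ∀ a b c d → (a + b) - (c + d) ≡ (a - c) + (b - d)
  +-diff = solve 4 (λ a b c d → (a :+ b) :- (c :+ d) := (a :- c) :+ (b :- d)) refl

  *-diff : ∀ a b c d → a * b - c * d ≡ a * (b - d) + d * (a - c)
  *-diff = solve 4 (λ a b c d →
    a :* b :- c :* d := a :* (b :- d) :+ d :* (a :- c)) refl

  half-pos : ∀ {ε} → 0ℚ < ε → 0ℚ < ½ * ε
  half-pos {ε} 0<ε = subst (_< ½ * ε) (ℚₚ.*-zeroʳ ½) (ℚₚ.*-monoʳ-<-pos ½ 0<ε)

  half+half : ∀ ε → ½ * ε + ½ * ε ≡ ε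
  half+half ε = trans (sym (ℚₚ.*-distribʳ-+ ε ½ ½)) (ℚₚ.*-identityˡ ε)

  abstract
    const-cauchy : ∀ q → Cauchy (λ _ → q)
    const-cauchy q ε 0<ε = 0 , λ _ _ _ _ →
      subst (λ d → ∣ d ∣ ≤ ε) (sym (ℚₚ.+-inverseʳ q)) (ℚₚ.<⇒≤ 0<ε)

  abstract
    +-cauchy : ∀ {x y} → Cauchy x → Cauchy y → Cauchy (λ n → x n + y n)
    +-cauchy {x} {y} cx cy ε 0<ε
      with M , p ← cx (½ * ε) (half-pos 0<ε)
      with N , q ← cy (½ * ε) (half-pos 0<ε) = M ⊔ N , λ m n hm hn → begin
        ∣ (x m + y m) - (x n + y n) ∣
          ≡⟨ cong ∣_∣ (+-diff (x m) (y m) (x n) (y n)) ⟩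
        ∣ (x m - x n) + (y m - y n) ∣
          ≤⟨ ℚₚ.∣p+q∣≤∣p∣+∣q∣ (x m - x n) (y m - y n) ⟩
        ∣ x m - x n ∣ + ∣ y m - y n ∣
          ≤⟨ ℚₚ.+-mono-≤
               (p m n (ℕₚ.m⊔n≤o⇒m≤o M N hm) (ℕₚ.m⊔n≤o⇒m≤o M N hn))
               (q m n (ℕₚ.m⊔n≤o⇒n≤o M N hm) (ℕₚ.m⊔n≤o⇒n≤o M N hn)) ⟩
        ½ * ε + ½ * ε
          ≡⟨ half+half ε ⟩
        ε ∎

  bounded : ∀ {x} → Cauchy x →
    ∃[ B ] ∃[ N ] (0ℚ < B × (∀ n → N ℕ.≤ n → ∣ x n ∣ ≤ B))
  bounded {x} cx with N , p ← cx 1ℚ (ℚₚ.positive⁻¹ 1ℚ) =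
    ∣ x N ∣ + 1ℚ , N , ℚₚ.+-mono-≤-< (ℚₚ.0≤∣p∣ (x N)) (ℚₚ.positive⁻¹ 1ℚ) , λ n hn → begin
      ∣ x n ∣
        ≡⟨ cong ∣_∣ (split (x n) (x N)) ⟩
      ∣ x N + (x n - x N) ∣
        ≤⟨ ℚₚ.∣p+q∣≤∣p∣+∣q∣ (x N) (x n - x N) ⟩
      ∣ x N ∣ + ∣ x n - x N ∣
        ≤⟨ ℚₚ.+-monoʳ-≤ ∣ x N ∣ (p n N hn ℕₚ.≤-refl) ⟩
      ∣ x N ∣ + 1ℚ ∎

  shrink : ∀ {B ε} → 0ℚ < B → 0ℚ < ε → ∃[ δ ] (0ℚ < δ × B * δ ≡ ε)
  shrink {B} {ε} 0<B 0<ε = 1/ B * ε , ℚₚ.positive⁻¹ (1/ B * ε) ,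
    trans (sym (ℚₚ.*-assoc B (1/ B) ε))
      (trans (cong (_* ε) (ℚₚ.*-inverseʳ B)) (ℚₚ.*-identityˡ ε))
    where
    instance
      posB = ℚ.positive 0<B
      nzB  = ℚₚ.pos⇒nonZero B
      posI = ℚₚ.1/pos⇒pos B
      posε = ℚ.positive 0<ε
      posδ = ℚₚ.pos*pos⇒pos (1/ B) ε

  ∣*∣-bound : ∀ {B δ} a b → 0ℚ < B → ∣ a ∣ ≤ B → ∣ b ∣ ≤ δ → ∣ a * b ∣ ≤ B * δ
  ∣*∣-bound {B} {δ} a b 0<B a≤B b≤δ = begin
    ∣ a * b ∣     ≡⟨ ℚₚ.∣p*q∣≡∣p∣*∣q∣ a b ⟩
    ∣ a ∣ * ∣ b ∣ ≤⟨ ℚₚ.*-monoʳ-≤-nonNeg ∣ b ∣ {{ℚₚ.∣-∣-nonNeg b}} a≤B ⟩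
    B * ∣ b ∣     ≤⟨ ℚₚ.*-monoˡ-≤-nonNeg B {{ℚ.nonNegative (ℚₚ.<⇒≤ 0<B)}} b≤δ ⟩
    B * δ         ∎

  *-bound : ∀ {A B α β ε} a b c d → 0ℚ < A → 0ℚ < B → A * β ≡ ε → B * α ≡ ε →
            ∣ a ∣ ≤ A → ∣ d ∣ ≤ B → ∣ a - c ∣ ≤ α → ∣ b - d ∣ ≤ β →
            ∣ a * b - c * d ∣ ≤ ε + ε
  *-bound {A} {B} {α} {β} {ε} a b c d 0<A 0<B Aβ Bα a≤A d≤B ac bd = begin
    ∣ a * b - c * d ∣
      ≡⟨ cong ∣_∣ (*-diff a b c d) ⟩
    ∣ a * (b - d) + d * (a - c) ∣
      ≤⟨ ℚₚ.∣p+q∣≤∣p∣+∣q∣ (a * (b - d)) (d * (a - c)) ⟩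
    ∣ a * (b - d) ∣ + ∣ d * (a - c) ∣
      ≤⟨ ℚₚ.+-mono-≤ (∣*∣-bound a (b - d) 0<A a≤A bd) (∣*∣-bound d (a - c) 0<B d≤B ac) ⟩
    A * β + B * α
      ≡⟨ cong₂ _+_ Aβ Bα ⟩
    ε + ε ∎

  abstract
    *-cauchy : ∀ {x y} → Cauchy x → Cauchy y → Cauchy (λ n → x n * y n)
    *-cauchy {x} {y} cx cy ε 0<ε =
      combine (bounded cx) (bounded cy)
      where
      Goal : Set
      Goal = ∃[ N ] (∀ m n → N ℕ.≤ m → N ℕ.≤ n → ∣ x m * y m - x n * y n ∣ ≤ ε)

      Bounded : (ℕ → ℚ) → Set
      Bounded z = ∃[ B ] ∃[ N ] (0ℚ < B × (∀ n → N ℕ.≤ n → ∣ z n ∣ ≤ B))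

      Close : (ℕ → ℚ) → ℚ → Set
      Close z δ = ∃[ N ] (∀ m n → N ℕ.≤ m → N ℕ.≤ n → ∣ z m - z n ∣ ≤ δ)

      combine : Bounded x → Bounded y → Goal
      combine (A , K , 0<A , a) (B , L , 0<B , b) =
        close (shrink 0<B (half-pos 0<ε)) (shrink 0<A (half-pos 0<ε))
        where
        finish : ∀ {α β} → B * α ≡ ½ * ε → A * β ≡ ½ * ε → Close x α → Close y β → Goal
        finish Bα Aβ (M , p) (N , q) = (K ⊔ L) ⊔ (M ⊔ N) , λ m n hm hn →
          let hm₁ = ℕₚ.m⊔n≤o⇒m≤o (K ⊔ L) (M ⊔ N) hm
              hm₂ = ℕₚ.m⊔n≤o⇒n≤o (K ⊔ L) (M ⊔ N) hm
              hn₁ = ℕₚ.m⊔n≤o⇒m≤o (K ⊔ L) (M ⊔ N) hn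
              hn₂ = ℕₚ.m⊔n≤o⇒n≤o (K ⊔ L) (M ⊔ N) hn
          in subst (∣ x m * y m - x n * y n ∣ ≤_) (half+half ε)
               (*-bound (x m) (y m) (x n) (y n) 0<A 0<B Aβ Bα
                 (a m (ℕₚ.m⊔n≤o⇒m≤o K L hm₁)) (b n (ℕₚ.m⊔n≤o⇒n≤o K L hn₁))
                 (p m n (ℕₚ.m⊔n≤o⇒m≤o M N hm₂) (ℕₚ.m⊔n≤o⇒m≤o M N hn₂))
                 (q m n (ℕₚ.m⊔n≤o⇒n≤o M N hm₂) (ℕₚ.m⊔n≤o⇒n≤o M N hn₂)))

        close : ∃[ α ] (0ℚ < α × B * α ≡ ½ * ε) → ∃[ β ] (0ℚ < β × A * β ≡ ½ * ε) → Goal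
        close (α , 0<α , Bα) (β , 0<β , Aβ) = finish Bα Aβ (cx α 0<α) (cy β 0<β)

fromℚ : ℚ → ℝ
fromℚ q = mkℝ (λ _ → q) (const-cauchy q)

fromℕ : ℕ → ℝ
fromℕ n = fromℚ (+ n / 1)

infixl 6 _+ᴿ_
infixl 7 _*ᴿ_
infixr 8 _^ᴿ_
infix  4 _≤ᴿ_ _<ᴿ_ _≈ᴿ_

_+ᴿ_ : ℝ → ℝ → ℝ
x +ᴿ y = mkℝ (λ n → seq x n + seq y n) (+-cauchy {seq x} {seq y} (cauchy x) (cauchy y))

_*ᴿ_ : ℝ → ℝ → ℝ
x *ᴿ y = mkℝ (λ n → seq x n * seq y n) (*-cauchy {seq x} {seq y} (cauchy x) (cauchy y))

_^ᴿ_ : ℝ → ℕ → ℝ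
x ^ᴿ zero  = fromℕ 1
x ^ᴿ suc n = x *ᴿ x ^ᴿ n

_≤ᴿ_ : ℝ → ℝ → Set
x ≤ᴿ y = ∀ ε → 0ℚ < ε → ∃[ N ] (∀ n → N ℕ.≤ n → seq x n ≤ seq y n + ε)

_<ᴿ_ : ℝ → ℝ → Set
x <ᴿ y = ∃[ ε ] (0ℚ < ε × ∃[ N ] (∀ n → N ℕ.≤ n → seq x n + ε ≤ seq y n))

_≈ᴿ_ : ℝ → ℝ → Set
x ≈ᴿ y = x ≤ᴿ y × y ≤ᴿ x

ConvergesTo : (ℕ → ℝ) → ℝ → Set
ConvergesTo f l = ∀ ε → 0ℚ < ε →
  ∃[ N ] (∀ n → N ℕ.≤ n → f n ≤ᴿ l +ᴿ fromℚ ε × l ≤ᴿ f n +ᴿ fromℚ ε)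

------------------------------------------------------------------------
-- Square root and natural logarithm, as (single-valued up to _≈ᴿ_) graphs

IsSqrt : ℝ → ℝ → Set
IsSqrt s x = fromℕ 0 ≤ᴿ s × s *ᴿ s ≈ᴿ x

-- 1 + x + x² / 2! + ⋯ + xⁿ / n!
expSum : ℝ → ℕ → ℝ
expSum x zero    = fromℕ 1
expSum x (suc n) =
  expSum x n +ᴿ fromℚ (_/_ 1ℤ (suc n !) {{suc n ℕₚ.!≢0}}) *ᴿ x ^ᴿ suc n

-- l = log x, i.e. exp l = x
IsLog : ℝ → ℝ → Set
IsLog l x = ConvergesTo (expSum l) x

------------------------------------------------------------------------
-- The sum

-- The inequality ∑_{t ∈ P} 1 ≤ b.  A sum of non-negative terms is the supremum of its finite
-- partial sums, and a finite partial sum here is the length of a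
-- duplicate-free list of elements of P.  This form does not need P to be
-- decidable, which a comparison with a real number is not.
Sum1≤ : {A : Set} → (A → Set) → ℝ → Set
Sum1≤ {A} P b = ∀ (ts : List A) → Unique ts → All P ts → fromℕ (length ts) ≤ᴿ b

-- The range of summation of (r₁ , r₂ , d₁ , d₂).
Range : ℤ → ℝ → ℕ × ℕ × ℕ × ℕ → Set
Range Δ X (r₁ , r₂ , d₁ , d₂) =
    (1 ℕ.≤ r₁ × gcd (+ r₁) Δ ≡ 1ℤ)
  × (1 ℕ.≤ r₂ × gcd (+ r₂) Δ ≡ 1ℤ)
  × (1 ℕ.≤ d₁ × (∀ q → Prime q → q ∣ d₁ → (+ q) ∣ᶻ Δ))
  × (1 ℕ.≤ d₂ × (∀ q → Prime q → q ∣ d₂ → (+ q) ∣ᶻ Δ))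
  × fromℕ (lcm (r₁ ℕ.^ 2 ℕ.* d₁) (r₂ ℕ.^ 2 ℕ.* d₂)) ≤ᴿ X

{-# OPTIONS --safe #-}

-- Write r₁ = a g and r₂ = b g with g = (r₁, r₂).  Since the rᵢ are coprime to the dᵢ, the number
-- (a b g)² dᵢ divides L = [r₁² d₁, r₂² d₂] for i = 1, 2, whence (a b g)⁴ d₁ d₂ ≤ L² ≤ X².  For
-- given a, b, d₁, d₂ there are thus at most √X (d₁ d₂)^(-1/4) / (a b) choices of g.  Summing over
-- a, b ≤ X gives the square of a harmonic sum, that is O(log² X); the sum of d^(-1/4) over all d
-- with prime factors dividing Δ converges, being dominated by a finite product of geometric series.
-- The harmonic sum H_M with M ≤ X is O(log X) because exp (y + h) ≤ exp y / (1 - h) yields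
-- exp (¼ H_M) ≤ ∏ (1 - 1 / (4 i))⁻¹ ≤ (M + 3) / 3 over 1 ≤ i ≤ M.
module Submission where

open import Defs
open import Data.Integer.Base as ℤ using (ℤ; +_; 0ℤ; 1ℤ)
open import Data.Integer.Divisibility using () renaming (_∣_ to _∣ᶻ_)
import Data.Integer.GCD as ℤ
import Data.Integer.Properties as ℤₚ
open import Data.List.Base
  using (List; []; _∷_; _++_; map; length; filter; downFrom; cartesianProduct; cartesianProductWith)
open import Data.List.Membership.Propositional using (_∈_)
open import Data.List.Membership.Propositional.Properties
  using (∈-downFrom⁺; ∈-cartesianProduct⁺; ∈-cartesianProductWith⁺)
open import Data.List.Relation.Unary.All as All using (All; []; _∷_)
import Data.List.Relation.Unary.All.Properties as All
open import Data.List.Relation.Unary.AllPairs using (_∷_)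
open import Data.List.Relation.Unary.Any using (here; there)
open import Data.List.Relation.Unary.Unique.Propositional using (Unique)
import Data.List.Relation.Unary.Unique.Propositional.Properties as Unique
open import Data.Nat.Base as ℕ using (ℕ; zero; suc; pred; z≤n; s≤s; ⌊_/2⌋; _!)
open import Data.Nat.Coprimality as Coprime using (Coprime; coprime-divisor; GCD≡1⇒coprime)
open import Data.Nat.Divisibility
open import Data.Nat.GCD using (gcd; gcd[m,n]∣m; gcd[m,n]∣n; gcd-greatest; gcd-GCD; GCD; GCD-*)
open import Data.Nat.Induction using (<-rec)
open import Data.Nat.LCM using (lcm; m∣lcm[m,n]; n∣lcm[m,n]; gcd*lcm)
open import Data.Nat.Logarithm
  using (⌊log₂_⌋; ⌊log₂⌋-mono-≤; ⌊log₂⌊n/2⌋⌋≡⌊log₂n⌋∸1; ⌊log₂[2^n]⌋≡n)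
open import Data.Nat.Primality using (Prime; prime⇒nonTrivial; ¬prime[1])
open import Data.Nat.Primality.Factorisation using (factorise)
import Data.Nat.Properties as ℕₚ
open import Data.Nat.Solver as ℕSolver using ()
open import Data.Product.Base using (∃-syntax; _×_; _,_; proj₁; proj₂)
open import Data.Product.Properties using (≡-dec)
open import Data.Rational.Base as ℚ
  using (ℚ; mkℚ; 0ℚ; 1ℚ; ½; ∣_∣; _/_; 1/_; _+_; _*_; _-_; -_; _≤_; _<_; toℚᵘ)
import Data.Rational.Properties as ℚₚ
open import Data.Rational.Solver using (module +-*-Solver)
import Data.Rational.Unnormalised.Base as ℚᵘ
import Data.Rational.Unnormalised.Properties as ℚᵘₚ
open import Data.Sum.Base using (_⊎_; inj₁; inj₂)
open import Function.Base using (_∘_)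
open import Relation.Binary.Definitions using (DecidableEquality)
open import Relation.Binary.PropositionalEquality
open import Relation.Nullary.Decidable using (yes; no; True; False; toWitness; toWitnessFalse)
open import Relation.Nullary.Negation using (¬_; contradiction)
open import Relation.Unary using (Decidable)
open import Relation.Unary.Properties using (∁?)
open +-*-Solver using (solve; _:+_; _:*_; _:-_; _:=_; con)

0≤+ : ∀ {p q} → 0ℚ ≤ p → 0ℚ ≤ q → 0ℚ ≤ p + q
0≤+ = ℚₚ.+-mono-≤

*-monoˡ : ∀ {p q} r → 0ℚ ≤ r → p ≤ q → r * p ≤ r * q
*-monoˡ r 0≤r = ℚₚ.*-monoˡ-≤-nonNeg r {{ℚ.nonNegative 0≤r}}

*-monoʳ : ∀ {p q} r → 0ℚ ≤ r → p ≤ q → p * r ≤ q * r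
*-monoʳ r 0≤r = ℚₚ.*-monoʳ-≤-nonNeg r {{ℚ.nonNegative 0≤r}}

0≤* : ∀ {p q} → 0ℚ ≤ p → 0ℚ ≤ q → 0ℚ ≤ p * q
0≤* {p} {q} 0≤p 0≤q = subst (_≤ p * q) (ℚₚ.*-zeroʳ p) (*-monoˡ p 0≤p 0≤q)

*-mono : ∀ {p q r s} → 0ℚ ≤ r → 0ℚ ≤ q → p ≤ q → r ≤ s → p * r ≤ q * s
*-mono {q = q} {r} 0≤r 0≤q p≤q r≤s = ℚₚ.≤-trans (*-monoʳ r 0≤r p≤q) (*-monoˡ q 0≤q r≤s)

p≤q⇒0≤q-p : ∀ {p q} → p ≤ q → 0ℚ ≤ q - p
p≤q⇒0≤q-p {p} {q} p≤q = subst (_≤ q - p) (ℚₚ.+-inverseʳ p) (ℚₚ.+-monoˡ-≤ (- p) p≤q)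

-- Linear and polynomial inequalities are reduced to the non-negativity of a difference that the
-- ring solver rewrites as a combination of known non-negative terms.
0≤q-p⇒p≤q : ∀ {p q r} → q - p ≡ r → 0ℚ ≤ r → p ≤ q
0≤q-p⇒p≤q {p} {q} refl 0≤r = subst₂ _≤_ (ℚₚ.+-identityʳ p)
  (solve 2 (λ p q → p :+ (q :- p) := q) refl p q) (ℚₚ.+-monoʳ-≤ p 0≤r)

0≤p² : ∀ p → 0ℚ ≤ p * p
0≤p² p with ℚₚ.≤-total 0ℚ p
... | inj₁ 0≤p = 0≤* 0≤p 0≤p
... | inj₂ p≤0 = subst (0ℚ ≤_) (solve 1 (λ p → (con 0ℚ :- p) :* (con 0ℚ :- p) := p :* p) refl p)
                   (0≤* (p≤q⇒0≤q-p p≤0) (p≤q⇒0≤q-p p≤0))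

²-cancel-≤ : ∀ {p q} → 0ℚ ≤ q → p * p ≤ q * q → p ≤ q
²-cancel-≤ {p} {q} 0≤q p²≤q² with p ℚₚ.≤? q
... | yes p≤q = p≤q
... | no p≰q = contradiction (ℚₚ.≤-<-trans p²≤q² q²<p²) (ℚₚ.<-irrefl refl)
  where
  q<p : q < p
  q<p = ℚₚ.≰⇒> p≰q
  q²<p² : q * q < p * p
  q²<p² = ℚₚ.≤-<-trans (*-monoˡ q 0≤q (ℚₚ.<⇒≤ q<p))
    (ℚₚ.*-monoˡ-<-pos p {{ℚ.positive (ℚₚ.≤-<-trans 0≤q q<p)}} q<p)

≤-const : ∀ p q {p≤q : True (p ℚₚ.≤? q)} → p ≤ q
≤-const p q {p≤q} = toWitness p≤q

≰-const : ∀ p q {p≰q : False (p ℚₚ.≤? q)} → ¬ p ≤ q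
≰-const p q {p≰q} = toWitnessFalse p≰q

ι : ℕ → ℚ
ι n = + n / 1

private
  toι : ∀ n → toℚᵘ (ι n) ℚᵘ.≃ ℚᵘ.mkℚᵘ (+ n) 0
  toι n = ℚₚ.toℚᵘ-fromℚᵘ (ℚᵘ.mkℚᵘ (+ n) 0)

ι-+ : ∀ m n → ι (m ℕ.+ n) ≡ ι m + ι n
ι-+ m n = ℚₚ.toℚᵘ-injective (ℚᵘₚ.≃-trans (toι (m ℕ.+ n)) (ℚᵘₚ.≃-trans
  (ℚᵘ.*≡* (cong (ℤ._* 1ℤ) (trans (ℤₚ.pos-+ m n)
    (sym (cong₂ ℤ._+_ (ℤₚ.*-identityʳ (+ m)) (ℤₚ.*-identityʳ (+ n)))))))
  (ℚᵘₚ.≃-sym (ℚᵘₚ.≃-trans (ℚₚ.toℚᵘ-homo-+ (ι m) (ι n)) (ℚᵘₚ.+-cong (toι m) (toι n))))))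

ι-* : ∀ m n → ι (m ℕ.* n) ≡ ι m * ι n
ι-* m n = ℚₚ.toℚᵘ-injective (ℚᵘₚ.≃-trans (toι (m ℕ.* n)) (ℚᵘₚ.≃-trans
  (ℚᵘ.*≡* (cong (ℤ._* 1ℤ) (ℤₚ.pos-* m n)))
  (ℚᵘₚ.≃-sym (ℚᵘₚ.≃-trans (ℚₚ.toℚᵘ-homo-* (ι m) (ι n)) (ℚᵘₚ.*-cong (toι m) (toι n))))))

0≤ι : ∀ n → 0ℚ ≤ ι n
0≤ι n = ℚₚ.nonNegative⁻¹ (ι n) {{ℚₚ.normalize-nonNeg n 1}}

ι-mono : ∀ {m n} → m ℕ.≤ n → ι m ≤ ι n
ι-mono {m} {n} m≤n = subst₂ _≤_ (ℚₚ.+-identityʳ (ι m))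
  (trans (sym (ι-+ m (n ℕ.∸ m))) (cong ι (ℕₚ.m+[n∸m]≡n m≤n)))
  (ℚₚ.+-monoʳ-≤ (ι m) (0≤ι (n ℕ.∸ m)))

ι-suc : ∀ n → ι (suc n) ≡ 1ℚ + ι n
ι-suc = ι-+ 1

1/ι : (n : ℕ) .{{_ : ℕ.NonZero n}} → ℚ
1/ι n = 1ℤ / n

0≤1/ι : ∀ n .{{_ : ℕ.NonZero n}} → 0ℚ ≤ 1/ι n
0≤1/ι n = ℚₚ.nonNegative⁻¹ (1/ι n) {{ℚₚ.normalize-nonNeg 1 n}}

ι*1/ι : ∀ n .{{_ : ℕ.NonZero n}} → ι n * 1/ι n ≡ 1ℚ
ι*1/ι (suc n) = ℚₚ.toℚᵘ-injective (ℚᵘₚ.≃-trans (ℚₚ.toℚᵘ-homo-* (ι (suc n)) (1/ι (suc n)))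
  (ℚᵘₚ.≃-trans (ℚᵘₚ.*-cong (toι (suc n)) (ℚₚ.toℚᵘ-fromℚᵘ (ℚᵘ.mkℚᵘ 1ℤ n)))
  (ℚᵘ.*≡* (trans (trans (ℤₚ.*-identityʳ (+ suc n ℤ.* 1ℤ)) (ℤₚ.*-identityʳ (+ suc n)))
    (sym (trans (ℤₚ.*-identityˡ (+ (1 ℕ.* suc n))) (cong +_ (ℕₚ.*-identityˡ (suc n)))))))))

archimedean : ∀ p → ∃[ n ] (p ≤ ι n)
archimedean p@(mkℚ _ _ _) = ℤ.∣ ℚ.↥ p ∣ , ℚₚ.toℚᵘ-cancel-≤ (ℚᵘₚ.≤-trans le (ℚᵘₚ.≤-reflexive (ℚᵘₚ.≃-sym (toι _))))
  where
  open ℤₚ.≤-Reasoning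
  le : toℚᵘ p ℚᵘ.≤ ℚᵘ.mkℚᵘ (+ ℤ.∣ ℚ.↥ p ∣) 0
  le = ℚᵘ.*≤* (begin
    ℚᵘ.↥ (toℚᵘ p) ℤ.* 1ℤ  ≡⟨ ℤₚ.*-identityʳ _ ⟩
    ℚᵘ.↥ (toℚᵘ p)         ≤⟨ i≤∣i∣ (ℚᵘ.↥ (toℚᵘ p)) ⟩
    + ℤ.∣ ℚᵘ.↥ (toℚᵘ p) ∣ ≡⟨ ℤₚ.*-identityʳ _ ⟨
    + ℤ.∣ ℚᵘ.↥ (toℚᵘ p) ∣ ℤ.* 1ℤ ≤⟨ ℤₚ.*-monoˡ-≤-nonNeg (+ ℤ.∣ ℚᵘ.↥ (toℚᵘ p) ∣) (ℤ.+≤+ (s≤s z≤n)) ⟩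
    + ℤ.∣ ℚᵘ.↥ (toℚᵘ p) ∣ ℤ.* ℚᵘ.↧ (toℚᵘ p) ∎)
    where
    i≤∣i∣ : ∀ i → i ℤ.≤ + ℤ.∣ i ∣
    i≤∣i∣ (+ n) = ℤₚ.≤-refl
    i≤∣i∣ (ℤ.-[1+ n ]) = ℤ.-≤+

2^⌊log₂n⌋≤n : ∀ n → 1 ℕ.≤ n → 2 ℕ.^ ⌊log₂ n ⌋ ℕ.≤ n
2^⌊log₂n⌋≤n = <-rec _ go
  where
  open ℕₚ.≤-Reasoning
  go : ∀ n → (∀ {m} → m ℕ.< n → 1 ℕ.≤ m → 2 ℕ.^ ⌊log₂ m ⌋ ℕ.≤ m) → 1 ℕ.≤ n → 2 ℕ.^ ⌊log₂ n ⌋ ℕ.≤ n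
  go 1 rec 1≤n = ℕₚ.≤-refl
  go n@(suc (suc k)) rec 1≤n = begin
    2 ℕ.^ ⌊log₂ n ⌋               ≡⟨ cong (2 ℕ.^_) (ℕₚ.m+[n∸m]≡n 1≤log) ⟨
    2 ℕ.* 2 ℕ.^ (⌊log₂ n ⌋ ℕ.∸ 1) ≡⟨ cong (λ l → 2 ℕ.* 2 ℕ.^ l) (⌊log₂⌊n/2⌋⌋≡⌊log₂n⌋∸1 n) ⟨
    2 ℕ.* 2 ℕ.^ ⌊log₂ ⌊ n /2⌋ ⌋   ≤⟨ ℕₚ.*-monoʳ-≤ 2 (rec (ℕₚ.⌊n/2⌋<n (suc k)) (s≤s z≤n)) ⟩
    2 ℕ.* ⌊ n /2⌋                 ≡⟨ cong (⌊ n /2⌋ ℕ.+_) (ℕₚ.+-identityʳ ⌊ n /2⌋) ⟩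
    ⌊ n /2⌋ ℕ.+ ⌊ n /2⌋           ≤⟨ ℕₚ.+-monoʳ-≤ ⌊ n /2⌋ (ℕₚ.⌊n/2⌋≤⌈n/2⌉ n) ⟩
    ⌊ n /2⌋ ℕ.+ ℕ.⌈ n /2⌉         ≡⟨ ℕₚ.⌊n/2⌋+⌈n/2⌉≡n n ⟩
    n ∎
    where
    1≤log : 1 ℕ.≤ ⌊log₂ n ⌋
    1≤log = ⌊log₂⌋-mono-≤ (s≤s (s≤s (z≤n {k})))

⌊log₂⌋-superadditive : ∀ {m n} → 1 ℕ.≤ m → 1 ℕ.≤ n → ⌊log₂ m ⌋ ℕ.+ ⌊log₂ n ⌋ ℕ.≤ ⌊log₂ (m ℕ.* n) ⌋
⌊log₂⌋-superadditive {m} {n} 1≤m 1≤n = begin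
  ⌊log₂ m ⌋ ℕ.+ ⌊log₂ n ⌋                        ≡⟨ ⌊log₂[2^n]⌋≡n _ ⟨
  ⌊log₂ (2 ℕ.^ (⌊log₂ m ⌋ ℕ.+ ⌊log₂ n ⌋)) ⌋      ≡⟨ cong ⌊log₂_⌋ (ℕₚ.^-distribˡ-+-* 2 ⌊log₂ m ⌋ _) ⟩
  ⌊log₂ (2 ℕ.^ ⌊log₂ m ⌋ ℕ.* 2 ℕ.^ ⌊log₂ n ⌋) ⌋  ≤⟨ ⌊log₂⌋-mono-≤ (ℕₚ.*-mono-≤ (2^⌊log₂n⌋≤n m 1≤m) (2^⌊log₂n⌋≤n n 1≤n)) ⟩
  ⌊log₂ (m ℕ.* n) ⌋ ∎
  where open ℕₚ.≤-Reasoning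

open ℚₚ.≤-Reasoning

-- Counting by fibres

Σℚ : {A : Set} → (A → ℚ) → List A → ℚ
Σℚ f []       = 0ℚ
Σℚ f (x ∷ xs) = f x + Σℚ f xs

Σℚ-mono : ∀ {A : Set} {f g : A → ℚ} → (∀ x → f x ≤ g x) → ∀ xs → Σℚ f xs ≤ Σℚ g xs
Σℚ-mono f≤g []       = ℚₚ.≤-refl
Σℚ-mono f≤g (x ∷ xs) = ℚₚ.+-mono-≤ (f≤g x) (Σℚ-mono f≤g xs)

0≤Σℚ : ∀ {A : Set} {f : A → ℚ} → (∀ x → 0ℚ ≤ f x) → ∀ xs → 0ℚ ≤ Σℚ f xs
0≤Σℚ 0≤f []       = ℚₚ.≤-refl
0≤Σℚ 0≤f (x ∷ xs) = 0≤+ (0≤f x) (0≤Σℚ 0≤f xs)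

Σℚ-*ˡ : ∀ {A : Set} c (f : A → ℚ) xs → Σℚ (λ x → c * f x) xs ≡ c * Σℚ f xs
Σℚ-*ˡ c f []       = sym (ℚₚ.*-zeroʳ c)
Σℚ-*ˡ c f (x ∷ xs) = trans (cong (_+_ (c * f x)) (Σℚ-*ˡ c f xs)) (sym (ℚₚ.*-distribˡ-+ c (f x) (Σℚ f xs)))

Σℚ-++ : ∀ {A : Set} (f : A → ℚ) xs ys → Σℚ f (xs ++ ys) ≡ Σℚ f xs + Σℚ f ys
Σℚ-++ f []       ys = sym (ℚₚ.+-identityˡ (Σℚ f ys))
Σℚ-++ f (x ∷ xs) ys = trans (cong (_+_ (f x)) (Σℚ-++ f xs ys)) (sym (ℚₚ.+-assoc (f x) (Σℚ f xs) (Σℚ f ys)))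

Σℚ-map : ∀ {A B : Set} (f : B → ℚ) (g : A → B) xs → Σℚ f (map g xs) ≡ Σℚ (f ∘ g) xs
Σℚ-map f g []       = refl
Σℚ-map f g (x ∷ xs) = cong (_+_ (f (g x))) (Σℚ-map f g xs)

Σℚ-cartesianProductWith : ∀ {A B C : Set} {f : C → ℚ} {u : A → ℚ} {v : B → ℚ} (_∙_ : A → B → C) →
  (∀ x y → f (x ∙ y) ≤ u x * v y) →
  ∀ xs ys → Σℚ f (cartesianProductWith _∙_ xs ys) ≤ Σℚ u xs * Σℚ v ys
Σℚ-cartesianProductWith {v = v} _∙_ f≤uv [] ys = ℚₚ.≤-reflexive (sym (ℚₚ.*-zeroˡ (Σℚ v ys)))
Σℚ-cartesianProductWith {f = f} {u} {v} _∙_ f≤uv (x ∷ xs) ys = begin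
  Σℚ f (map (x ∙_) ys ++ cartesianProductWith _∙_ xs ys)
    ≡⟨ Σℚ-++ f (map (x ∙_) ys) _ ⟩
  Σℚ f (map (x ∙_) ys) + Σℚ f (cartesianProductWith _∙_ xs ys)
    ≡⟨ cong (_+ Σℚ f (cartesianProductWith _∙_ xs ys)) (Σℚ-map f (x ∙_) ys) ⟩
  Σℚ (λ y → f (x ∙ y)) ys + Σℚ f (cartesianProductWith _∙_ xs ys)
    ≤⟨ ℚₚ.+-mono-≤ (Σℚ-mono (f≤uv x) ys) (Σℚ-cartesianProductWith _∙_ f≤uv xs ys) ⟩
  Σℚ (λ y → u x * v y) ys + Σℚ u xs * Σℚ v ys
    ≡⟨ cong (_+ Σℚ u xs * Σℚ v ys) (Σℚ-*ˡ (u x) v ys) ⟩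
  u x * Σℚ v ys + Σℚ u xs * Σℚ v ys
    ≡⟨ ℚₚ.*-distribʳ-+ (Σℚ v ys) (u x) (Σℚ u xs) ⟨
  (u x + Σℚ u xs) * Σℚ v ys ∎

-- The rational analogue of Sum1≤.
Count≤ : {A : Set} → (A → Set) → ℚ → Set
Count≤ {A} P q = ∀ (ts : List A) → Unique ts → All P ts → ι (length ts) ≤ q

Count≤-mono : ∀ {A : Set} {P Q : A → Set} {p q} → (∀ {t} → Q t → P t) → p ≤ q → Count≤ P p → Count≤ Q q
Count≤-mono Q⊆P p≤q c ts uts ats = ℚₚ.≤-trans (c ts uts (All.map Q⊆P ats)) p≤q

length-filter+filter-∁ : ∀ {A : Set} {P : A → Set} (P? : Decidable P) xs →
  length (filter P? xs) ℕ.+ length (filter (∁? P?) xs) ≡ length xs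
length-filter+filter-∁ P? []       = refl
length-filter+filter-∁ P? (x ∷ xs) with P? x
... | yes _ = cong suc (length-filter+filter-∁ P? xs)
... | no  _ = trans (ℕₚ.+-suc _ _) (cong suc (length-filter+filter-∁ P? xs))

Count≤-fibres : ∀ {A B : Set} (_≟_ : DecidableEquality B) (κ : A → B) (f : B → ℚ) (bs : List B)
  {P : A → Set} → (∀ {t} → P t → κ t ∈ bs) →
  (∀ b → Count≤ (λ t → P t × κ t ≡ b) (f b)) → Count≤ P (Σℚ f bs)
Count≤-fibres _≟_ κ f [] κ∈ fib [] uts ats = ℚₚ.≤-refl
Count≤-fibres _≟_ κ f [] κ∈ fib (t ∷ ts) uts (p ∷ ats) = contradiction (κ∈ p) λ ()
Count≤-fibres {A} {B} _≟_ κ f (b ∷ bs) {P} κ∈ fib ts uts ats = begin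
  ι (length ts)
    ≡⟨ cong ι (length-filter+filter-∁ =b? ts) ⟨
  ι (length (filter =b? ts) ℕ.+ length (filter (∁? =b?) ts))
    ≡⟨ ι-+ (length (filter =b? ts)) _ ⟩
  ι (length (filter =b? ts)) + ι (length (filter (∁? =b?) ts))
    ≤⟨ ℚₚ.+-mono-≤
         (fib b _ (Unique.filter⁺ =b? uts) (All.zip (All.filter⁺ =b? ats , All.all-filter =b? ts)))
         (Count≤-fibres _≟_ κ f bs κ∈bs
           (λ b′ → Count≤-mono (λ { ((p , _) , e) → p , e }) ℚₚ.≤-refl (fib b′)) _
           (Unique.filter⁺ (∁? =b?) uts)
           (All.zip (All.filter⁺ (∁? =b?) ats , All.all-filter (∁? =b?) ts))) ⟩
  f b + Σℚ f bs ∎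
  where
  =b? : Decidable (λ t → κ t ≡ b)
  =b? t = κ t ≟ b
  κ∈bs : ∀ {t} → P t × κ t ≢ b → κ t ∈ bs
  κ∈bs (p , κ≢b) with κ∈ p
  ... | here κ≡b = contradiction κ≡b κ≢b
  ... | there ∈bs = ∈bs

Count≤-1 : ∀ {A : Set} {P : A → Set} → (∀ {t u} → P t → P u → t ≡ u) → Count≤ P 1ℚ
Count≤-1 eq []           uts ats = ≤-const _ _
Count≤-1 eq (_ ∷ [])     uts ats = ℚₚ.≤-refl
Count≤-1 eq (_ ∷ _ ∷ _) ((t≢u ∷ _) ∷ _) (p ∷ q ∷ _) = contradiction (eq p q) t≢u

Σℚ-1 : ∀ n → Σℚ (λ _ → 1ℚ) (downFrom n) ≡ ι n
Σℚ-1 zero    = refl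
Σℚ-1 (suc n) = trans (cong (_+_ 1ℚ) (Σℚ-1 n)) (sym (ι-suc n))

Count≤-injection : ∀ {A : Set} {P : A → Set} {q} (g : A → ℕ) → 0ℚ ≤ q →
  (∀ {t} → P t → 1 ℕ.≤ g t × ι (g t) ≤ q) →
  (∀ {t u} → P t → P u → g t ≡ g u → t ≡ u) → Count≤ P q
Count≤-injection {A} {P} {q} g 0≤q g-range g-inj ts uts ats =
  let n , g≤n , n≤q = bound ats in ℚₚ.≤-trans (count n ts uts (All.zip (ats , g≤n))) n≤q
  where
  bound : ∀ {ts} → All P ts → ∃[ n ] (All (λ t → g t ℕ.≤ n) ts × ι n ≤ q)
  bound []       = 0 , [] , 0≤q
  bound {t ∷ _} (p ∷ ats) with n , g≤n , n≤q ← bound ats with ℕₚ.≤-total (g t) n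
  ... | inj₁ gt≤n = n , gt≤n ∷ g≤n , n≤q
  ... | inj₂ n≤gt = g t , ℕₚ.≤-refl ∷ All.map (λ le → ℕₚ.≤-trans le n≤gt) g≤n , proj₂ (g-range p)

  pred-inj : ∀ {m n} → 1 ℕ.≤ m → 1 ℕ.≤ n → pred m ≡ pred n → m ≡ n
  pred-inj (s≤s _) (s≤s _) = cong suc

  pred-< : ∀ {m n} → 1 ℕ.≤ m → m ℕ.≤ n → pred m ℕ.< n
  pred-< (s≤s _) m≤n = m≤n

  count : ∀ n → Count≤ (λ t → P t × g t ℕ.≤ n) (ι n)
  count n = Count≤-mono (λ p → p) (ℚₚ.≤-reflexive (Σℚ-1 n))
    (Count≤-fibres ℕₚ._≟_ (pred ∘ g) (λ _ → 1ℚ) (downFrom n)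
      (λ (p , g≤n) → ∈-downFrom⁺ (pred-< (proj₁ (g-range p)) g≤n))
      (λ b → Count≤-1 λ { ((p , _) , e) ((p′ , _) , e′) →
        g-inj p p′ (pred-inj (proj₁ (g-range p)) (proj₁ (g-range p′)) (trans e (sym e′))) }))

-- Smooth numbers

infixr 8 _^_
_^_ : ℚ → ℕ → ℚ
x ^ zero  = 1ℚ
x ^ suc n = x * x ^ n

^-+ : ∀ x m n → x ^ (m ℕ.+ n) ≡ x ^ m * x ^ n
^-+ x zero    n = sym (ℚₚ.*-identityˡ (x ^ n))
^-+ x (suc m) n = trans (cong (x *_) (^-+ x m n)) (sym (ℚₚ.*-assoc x (x ^ m) (x ^ n)))

0≤^ : ∀ {x} → 0ℚ ≤ x → ∀ n → 0ℚ ≤ x ^ n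
0≤^ 0≤x zero    = ≤-const _ _
0≤^ 0≤x (suc n) = 0≤* 0≤x (0≤^ 0≤x n)

^≤1 : ∀ {x} → 0ℚ ≤ x → x ≤ 1ℚ → ∀ n → x ^ n ≤ 1ℚ
^≤1 0≤x x≤1 zero    = ℚₚ.≤-refl
^≤1 0≤x x≤1 (suc n) = *-mono (0≤^ 0≤x n) (≤-const 0ℚ 1ℚ) x≤1 (^≤1 0≤x x≤1 n)

^-antitone : ∀ {x m n} → 0ℚ ≤ x → x ≤ 1ℚ → m ℕ.≤ n → x ^ n ≤ x ^ m
^-antitone {x} 0≤x x≤1 (z≤n {n})     = ^≤1 0≤x x≤1 n
^-antitone {x} 0≤x x≤1 (s≤s m≤n) = *-monoˡ x 0≤x (^-antitone 0≤x x≤1 m≤n)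

ρ : ℚ
ρ = + 7 / 8

0≤ρ : 0ℚ ≤ ρ
0≤ρ = ≤-const _ _

ρ≤1 : ρ ≤ 1ℚ
ρ≤1 = ≤-const _ _

-- A rational stand-in for n^(-1/4): ρ⁴ ≥ 1/2 makes it large enough, and it is submultiplicative,
-- which at n = 0 needs the value 0.
weight : ℕ → ℚ
weight zero      = 0ℚ
weight n@(suc _) = ρ ^ ⌊log₂ n ⌋

0≤weight : ∀ n → 0ℚ ≤ weight n
0≤weight zero      = ℚₚ.≤-refl
0≤weight n@(suc _) = 0≤^ 0≤ρ ⌊log₂ n ⌋

weight≤1 : ∀ n → weight n ≤ 1ℚ
weight≤1 zero      = ≤-const _ _
weight≤1 n@(suc _) = ^≤1 0≤ρ ρ≤1 ⌊log₂ n ⌋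

weight-* : ∀ m n → weight (m ℕ.* n) ≤ weight m * weight n
weight-* zero      n    = 0≤* ℚₚ.≤-refl (0≤weight n)
weight-* m@(suc _) zero rewrite ℕₚ.*-zeroʳ m = 0≤* (0≤weight m) ℚₚ.≤-refl
weight-* m@(suc _) n@(suc _) = ℚₚ.≤-trans
  (^-antitone 0≤ρ ρ≤1 (⌊log₂⌋-superadditive {m} {n} (s≤s z≤n) (s≤s z≤n)))
  (ℚₚ.≤-reflexive (^-+ ρ ⌊log₂ m ⌋ ⌊log₂ n ⌋))

weight-^ : ∀ {m} e → 2 ℕ.≤ m → weight (m ℕ.^ e) ≤ ρ ^ e
weight-^ {m} e 2≤m with m ℕ.^ e in eq
... | zero        = 0≤^ 0≤ρ e
... | n@(suc _) = ^-antitone 0≤ρ ρ≤1 (subst₂ ℕ._≤_ (⌊log₂[2^n]⌋≡n e) (cong ⌊log₂_⌋ eq)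
                    (⌊log₂⌋-mono-≤ (ℕₚ.^-monoˡ-≤ e 2≤m)))

infix 9 _⁴
_⁴ : ℚ → ℚ
x ⁴ = (x * x) * (x * x)

⁴-* : ∀ x y → (x * y) ⁴ ≡ x ⁴ * y ⁴
⁴-* = solve 2 (λ x y → ((x :* y) :* (x :* y)) :* ((x :* y) :* (x :* y))
  := ((x :* x) :* (x :* x)) :* ((y :* y) :* (y :* y))) refl

0≤x⁴ : ∀ x → 0ℚ ≤ x ⁴
0≤x⁴ x = 0≤p² (x * x)

⁴-cancel-≤ : ∀ {x y} → 0ℚ ≤ y → x ⁴ ≤ y ⁴ → x ≤ y
⁴-cancel-≤ {x} {y} 0≤y le = ²-cancel-≤ 0≤y (²-cancel-≤ (0≤p² y) le)

1≤weight⁴*n : ∀ n → 1 ℕ.≤ n → 1ℚ ≤ weight n ⁴ * ι n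
1≤weight⁴*n n@(suc _) 1≤n = ℚₚ.≤-trans (pow ⌊log₂ n ⌋)
  (*-monoˡ (weight n ⁴) (0≤x⁴ (weight n)) (ι-mono (2^⌊log₂n⌋≤n n 1≤n)))
  where
  pow : ∀ k → 1ℚ ≤ (ρ ^ k) ⁴ * ι (2 ℕ.^ k)
  pow zero    = ≤-const _ _
  pow (suc k) = begin
    1ℚ                                          ≤⟨ *-mono (≤-const 0ℚ 1ℚ) (≤-const _ _) (≤-const 1ℚ (ρ ⁴ * ι 2)) (pow k) ⟩
    (ρ ⁴ * ι 2) * ((ρ ^ k) ⁴ * ι (2 ℕ.^ k))     ≡⟨ solve 4 (λ a b c d → (a :* b) :* (c :* d) := (a :* c) :* (b :* d)) refl
                                                     (ρ ⁴) (ι 2) ((ρ ^ k) ⁴) (ι (2 ℕ.^ k)) ⟩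
    (ρ ⁴ * (ρ ^ k) ⁴) * (ι 2 * ι (2 ℕ.^ k))     ≡⟨ cong₂ _*_ (⁴-* ρ (ρ ^ k)) (ι-* 2 (2 ℕ.^ k)) ⟨
    (ρ ^ suc k) ⁴ * ι (2 ℕ.^ suc k) ∎

-- Composite bases are harmless: they only make the list longer.
smooth : (D K : ℕ) → List ℕ
smooth zero    K = 1 ∷ []
smooth (suc D) K = cartesianProductWith (λ e d → suc (suc D) ℕ.^ e ℕ.* d) (downFrom (suc K)) (smooth D K)

geometric : ∀ n → Σℚ (ρ ^_) (downFrom n) ≤ ι 8
geometric n = 0≤q-p⇒p≤q (remainder n) (0≤* (0≤ι 8) (0≤^ 0≤ρ n))
  where
  remainder : ∀ n → ι 8 - Σℚ (ρ ^_) (downFrom n) ≡ ι 8 * ρ ^ n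
  remainder zero    = refl
  remainder (suc n) = trans
    (solve 2 (λ x s → con (ι 8) :- (x :+ s) := (con (ι 8) :- s) :- x) refl (ρ ^ n) (Σℚ (ρ ^_) (downFrom n)))
    (trans (cong (_- ρ ^ n) (remainder n))
      (solve 1 (λ x → con (ι 8) :* x :- x := con (ι 8) :* (con ρ :* x)) refl (ρ ^ n)))

Σ-weight-smooth : ∀ D K → Σℚ weight (smooth D K) ≤ ι 8 ^ D
Σ-weight-smooth zero    K = ≤-const _ _
Σ-weight-smooth (suc D) K = ℚₚ.≤-trans
  (Σℚ-cartesianProductWith {u = ρ ^_} {v = weight} (λ e d → suc (suc D) ℕ.^ e ℕ.* d)
    (λ e d → ℚₚ.≤-trans (weight-* (suc (suc D) ℕ.^ e) d)
      (*-monoʳ (weight d) (0≤weight d) (weight-^ e (s≤s (s≤s z≤n)))))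
    (downFrom (suc K)) (smooth D K))
  (*-mono (0≤Σℚ 0≤weight (smooth D K)) (0≤ι 8) (geometric (suc K)) (Σ-weight-smooth D K))

∃-prime-divisor : ∀ n → 2 ℕ.≤ n → ∃[ p ] (Prime p × p ∣ n)
∃-prime-divisor n@(suc _) 2≤n with factorise n
... | record { factors = [] ; isFactorisation = n≡1 } = contradiction (sym n≡1) (ℕₚ.<⇒≢ 2≤n)
... | record { factors = p ∷ ps ; isFactorisation = n≡ ; factorsPrime = pr ∷ _ } =
  p , pr , subst (p ∣_) (sym n≡) (m∣m*n _)

remove-factor : ∀ {m} → 2 ℕ.≤ m → ∀ n → 1 ℕ.≤ n →
  ∃[ e ] ∃[ k ] (n ≡ m ℕ.^ e ℕ.* k × 1 ℕ.≤ k × m ∤ k)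
remove-factor {m} 2≤m = <-rec _ go
  where
  go : ∀ n → (∀ {i} → i ℕ.< n → 1 ℕ.≤ i → ∃[ e ] ∃[ k ] (i ≡ m ℕ.^ e ℕ.* k × 1 ℕ.≤ k × m ∤ k)) →
       1 ℕ.≤ n → ∃[ e ] ∃[ k ] (n ≡ m ℕ.^ e ℕ.* k × 1 ℕ.≤ k × m ∤ k)
  go n rec 1≤n with m ∣? n
  ... | no m∤n = 0 , n , sym (ℕₚ.*-identityˡ n) , 1≤n , m∤n
  ... | yes (divides zero    refl) = contradiction 1≤n λ ()
  ... | yes (divides i@(suc _) n≡i*m)
    with e , k , i≡ , 1≤k , m∤k ← rec (subst (i ℕ.<_) (sym n≡i*m) (ℕₚ.m<m*n i m 2≤m)) (s≤s z≤n)
    = suc e , k ,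
      trans n≡i*m (trans (ℕₚ.*-comm i m) (trans (cong (m ℕ.*_) i≡) (sym (ℕₚ.*-assoc m (m ℕ.^ e) k)))) ,
      1≤k , m∤k

e<m^e : ∀ {m} e → 2 ℕ.≤ m → e ℕ.< m ℕ.^ e
e<m^e zero    2≤m = s≤s z≤n
e<m^e {m@(suc _)} (suc e) 2≤m = ℕₚ.≤-<-trans (e<m^e e 2≤m)
  (subst (m ℕ.^ e ℕ.<_) (ℕₚ.*-comm (m ℕ.^ e) m) (ℕₚ.m<m*n (m ℕ.^ e) m {{ℕₚ.m^n≢0 m e}} 2≤m))

∈-smooth : ∀ D {K d} → 1 ℕ.≤ d → d ℕ.≤ K → (∀ q → Prime q → q ∣ d → q ℕ.≤ suc D) → d ∈ smooth D K
∈-smooth zero {d = d} 1≤d d≤K primes≤ with ℕₚ.m≤n⇒m<n∨m≡n 1≤d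
... | inj₂ refl = here refl
... | inj₁ 1<d with p , pr , p∣d ← ∃-prime-divisor d 1<d =
  contradiction (primes≤ p pr p∣d) (ℕₚ.<⇒≱ (ℕ.nonTrivial⇒n>1 p {{prime⇒nonTrivial pr}}))
∈-smooth (suc D) {K} {d} 1≤d d≤K primes≤
  with e , k , refl , 1≤k , m∤k ← remove-factor {suc (suc D)} (s≤s (s≤s z≤n)) d 1≤d =
  ∈-cartesianProductWith⁺ (λ e d → suc (suc D) ℕ.^ e ℕ.* d)
    (∈-downFrom⁺ (s≤s (ℕₚ.≤-trans (ℕₚ.<⇒≤ (e<m^e e (s≤s (s≤s z≤n)))) (ℕₚ.≤-trans m^e≤d d≤K))))
    (∈-smooth D 1≤k (ℕₚ.≤-trans k≤d d≤K) λ q pr q∣k →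
      ℕₚ.≤-pred (ℕₚ.≤∧≢⇒< (primes≤ q pr (∣n⇒∣m*n (suc (suc D) ℕ.^ e) q∣k)) λ { refl → m∤k q∣k }))
  where
  m^e≤d : suc (suc D) ℕ.^ e ℕ.≤ suc (suc D) ℕ.^ e ℕ.* k
  m^e≤d = ℕₚ.m≤m*n (suc (suc D) ℕ.^ e) k {{ℕ.>-nonZero 1≤k}}
  k≤d : k ℕ.≤ suc (suc D) ℕ.^ e ℕ.* k
  k≤d = ℕₚ.m≤n*m k (suc (suc D) ℕ.^ e) {{ℕₚ.m^n≢0 (suc (suc D)) e}}

-- The arithmetic of the range of summation

coprime-∣ : ∀ {m n o} → o ∣ m → Coprime m n → Coprime o n
coprime-∣ o∣m c (d∣o , d∣n) = c (∣-trans d∣o o∣m , d∣n)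

coprime-*ʳ : ∀ {m n o} → Coprime m n → Coprime m o → Coprime m (n ℕ.* o)
coprime-*ʳ c c′ (d∣m , d∣no) = c′ (d∣m , coprime-divisor (coprime-∣ d∣m c) d∣no)

coprime-² : ∀ {m n} → Coprime m n → Coprime (m ℕ.* m) (n ℕ.* n)
coprime-² c = Coprime.sym (coprime-*ʳ c² c²)
  where c² = Coprime.sym (coprime-*ʳ c c)

coprime-*-∣ : ∀ {m n k} → Coprime m n → m ∣ k → n ∣ k → m ℕ.* n ∣ k
coprime-*-∣ {m} {n} c (divides q refl) n∣qm =
  subst (_∣ q ℕ.* m) (ℕₚ.*-comm n m)
    (*-monoˡ-∣ m (coprime-divisor (Coprime.sym c) (subst (n ∣_) (ℕₚ.*-comm q m) n∣qm)))

coprime-primes : ∀ {m n} → 1 ℕ.≤ m → (∀ q → Prime q → q ∣ m → q ∤ n) → Coprime m n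
coprime-primes 1≤m disjoint {zero} (0∣m , _) = contradiction (0∣⇒≡0 0∣m) (ℕₚ.>⇒≢ 1≤m)
coprime-primes 1≤m disjoint {1} _ = refl
coprime-primes 1≤m disjoint {d@(suc (suc _))} (d∣m , d∣n)
  with q , pr , q∣d ← ∃-prime-divisor d (s≤s (s≤s z≤n)) =
  contradiction (∣-trans q∣d d∣n) (disjoint q pr (∣-trans q∣d d∣m))

cofactor₁ cofactor₂ : ℕ → ℕ → ℕ
cofactor₁ r s = quotient (gcd[m,n]∣m r s)
cofactor₂ r s = quotient (gcd[m,n]∣n r s)

cofactor₁-* : ∀ r s → r ≡ cofactor₁ r s ℕ.* gcd r s
cofactor₁-* r s = m∣n⇒n≡quotient*m (gcd[m,n]∣m r s)

cofactor₂-* : ∀ r s → s ≡ cofactor₂ r s ℕ.* gcd r s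
cofactor₂-* r s = m∣n⇒n≡quotient*m (gcd[m,n]∣n r s)

1≤* : ∀ m n → 1 ℕ.≤ m ℕ.* n → 1 ℕ.≤ m × 1 ℕ.≤ n
1≤* (suc m) (suc n) _ = s≤s z≤n , s≤s z≤n
1≤* (suc m) zero 1≤ rewrite ℕₚ.*-zeroʳ m = contradiction 1≤ λ ()

coprime-cofactors : ∀ r s → 1 ℕ.≤ r → Coprime (cofactor₁ r s) (cofactor₂ r s)
coprime-cofactors r s 1≤r = GCD≡1⇒coprime (GCD-* {c = gcd r s} {{ℕ.>-nonZero 1≤g}} gcd′)
  where
  1≤g : 1 ℕ.≤ gcd r s
  1≤g = proj₂ (1≤* (cofactor₁ r s) (gcd r s) (subst (1 ℕ.≤_) (cofactor₁-* r s) 1≤r))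
  gcd′ : GCD (cofactor₁ r s ℕ.* gcd r s) (cofactor₂ r s ℕ.* gcd r s) (1 ℕ.* gcd r s)
  gcd′ = subst₂ (λ m n → GCD m n (1 ℕ.* gcd r s)) (cofactor₁-* r s) (cofactor₂-* r s)
           (subst (GCD r s) (sym (ℕₚ.*-identityˡ (gcd r s))) (gcd-GCD r s))

-- Equal to lcm r s.
parts : ℕ → ℕ → ℕ
parts r s = cofactor₁ r s ℕ.* cofactor₂ r s ℕ.* gcd r s

parts²∣ : ∀ {r s k} → 1 ℕ.≤ r → r ℕ.* r ∣ k → s ℕ.* s ∣ k → parts r s ℕ.* parts r s ∣ k
parts²∣ {r} {s} {k} 1≤r r²∣k s²∣k
  with divides q refl ← ∣-trans (*-pres-∣ (gcd[m,n]∣m r s) (gcd[m,n]∣m r s)) r²∣k =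
  subst (_∣ q ℕ.* (g ℕ.* g)) (regroup a b g)
    (*-monoˡ-∣ (g ℕ.* g) (coprime-*-∣ (coprime-² (coprime-cofactors r s 1≤r))
      (*-cancelʳ-∣ {n = q} (g ℕ.* g) {{g²≢0}} (subst (_∣ q ℕ.* (g ℕ.* g)) (trans (cong₂ ℕ._*_ r≡ r≡) (swap a g)) r²∣k))
      (*-cancelʳ-∣ {n = q} (g ℕ.* g) {{g²≢0}} (subst (_∣ q ℕ.* (g ℕ.* g)) (trans (cong₂ ℕ._*_ s≡ s≡) (swap b g)) s²∣k))))
  where
  open ℕSolver.+-*-Solver using () renaming (solve to solveℕ; _:*_ to _:×_; _:=_ to _:≡_)
  a = cofactor₁ r s
  b = cofactor₂ r s
  g = gcd r s
  r≡ = cofactor₁-* r s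
  s≡ = cofactor₂-* r s
  g²≢0 : ℕ.NonZero (g ℕ.* g)
  g²≢0 = ℕ.>-nonZero (ℕₚ.*-mono-≤ 1≤g 1≤g)
    where
    1≤g : 1 ℕ.≤ g
    1≤g = proj₂ (1≤* a g (subst (1 ℕ.≤_) r≡ 1≤r))
  swap : ∀ a g → (a ℕ.* g) ℕ.* (a ℕ.* g) ≡ (a ℕ.* a) ℕ.* (g ℕ.* g)
  swap = solveℕ 2 (λ a g → (a :× g) :× (a :× g) :≡ (a :× a) :× (g :× g)) refl
  regroup : ∀ a b g → (a ℕ.* a) ℕ.* (b ℕ.* b) ℕ.* (g ℕ.* g) ≡ (a ℕ.* b ℕ.* g) ℕ.* (a ℕ.* b ℕ.* g)
  regroup = solveℕ 3 (λ a b g → (a :× a) :× (b :× b) :× (g :× g) :≡ (a :× b :× g) :× (a :× b :× g)) refl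

parts∣* : ∀ r s → parts r s ∣ r ℕ.* s
parts∣* r s = subst (_∣ r ℕ.* s) (sym (ℕₚ.*-assoc (cofactor₁ r s) (cofactor₂ r s) (gcd r s)))
  (*-pres-∣ (quotient-∣ (gcd[m,n]∣m r s)) (∣-reflexive (sym (cofactor₂-* r s))))

Tuple : Set
Tuple = ℕ × ℕ × ℕ × ℕ

modulus : Tuple → ℕ
modulus (r₁ , r₂ , d₁ , d₂) = lcm (r₁ ℕ.^ 2 ℕ.* d₁) (r₂ ℕ.^ 2 ℕ.* d₂)

Admissible : ℤ → Tuple → Set
Admissible Δ (r₁ , r₂ , d₁ , d₂) =
    (1 ℕ.≤ r₁ × ℤ.gcd (+ r₁) Δ ≡ 1ℤ)
  × (1 ℕ.≤ r₂ × ℤ.gcd (+ r₂) Δ ≡ 1ℤ)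
  × (1 ℕ.≤ d₁ × (∀ q → Prime q → q ∣ d₁ → (+ q) ∣ᶻ Δ))
  × (1 ℕ.≤ d₂ × (∀ q → Prime q → q ∣ d₂ → (+ q) ∣ᶻ Δ))

coprime-Δ : ∀ Δ {r d} → ℤ.gcd (+ r) Δ ≡ 1ℤ → 1 ℕ.≤ d →
  (∀ q → Prime q → q ∣ d → (+ q) ∣ᶻ Δ) → Coprime r d
coprime-Δ Δ gcd≡1 1≤d d-smooth = Coprime.sym (coprime-primes 1≤d λ q pr q∣d q∣r →
  ¬prime[1] (subst Prime (∣1⇒≡1 (subst (q ∣_) (ℤₚ.+-injective gcd≡1) (gcd-greatest q∣r (d-smooth q pr q∣d)))) pr))

1≤lcm : ∀ m n → 1 ℕ.≤ m → 1 ℕ.≤ n → 1 ℕ.≤ lcm m n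
1≤lcm m n 1≤m 1≤n = proj₂ (1≤* (gcd m n) (lcm m n) (subst (1 ℕ.≤_) (sym (gcd*lcm m n)) (ℕₚ.*-mono-≤ 1≤m 1≤n)))

module _ (Δ : ℤ) (t : Tuple) (adm : Admissible Δ t) where
  private
    r₁ = proj₁ t
    r₂ = proj₁ (proj₂ t)
    d₁ = proj₁ (proj₂ (proj₂ t))
    d₂ = proj₂ (proj₂ (proj₂ t))
    n = parts r₁ r₂
    L = modulus t
    1≤r₁ = proj₁ (proj₁ adm)
    1≤r₂ = proj₁ (proj₁ (proj₂ adm))
    1≤d₁ = proj₁ (proj₁ (proj₂ (proj₂ adm)))
    1≤d₂ = proj₁ (proj₂ (proj₂ (proj₂ adm)))

    r²∣r^2*d : ∀ r d → r ℕ.* r ∣ r ℕ.^ 2 ℕ.* d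
    r²∣r^2*d r d = subst (λ x → r ℕ.* r ∣ r ℕ.* x ℕ.* d) (sym (ℕₚ.*-identityʳ r)) (m∣m*n d)

    1≤r^2*d : ∀ r d → 1 ℕ.≤ r → 1 ℕ.≤ d → 1 ℕ.≤ r ℕ.^ 2 ℕ.* d
    1≤r^2*d r d 1≤r 1≤d = ℕₚ.*-mono-≤ (ℕₚ.*-mono-≤ 1≤r (ℕₚ.*-mono-≤ 1≤r ℕₚ.≤-refl)) 1≤d

    n²∣L : n ℕ.* n ∣ L
    n²∣L = parts²∣ {r₁} {r₂} 1≤r₁ (∣-trans (r²∣r^2*d r₁ d₁) (m∣lcm[m,n] (r₁ ℕ.^ 2 ℕ.* d₁) _))
                        (∣-trans (r²∣r^2*d r₂ d₂) (n∣lcm[m,n] (r₁ ℕ.^ 2 ℕ.* d₁) (r₂ ℕ.^ 2 ℕ.* d₂)))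

    n²*d∣L : ∀ {d} → 1 ℕ.≤ d → (∀ q → Prime q → q ∣ d → (+ q) ∣ᶻ Δ) → d ∣ L → n ℕ.* n ℕ.* d ∣ L
    n²*d∣L {d} 1≤d d-smooth d∣L = coprime-*-∣ (Coprime.sym (coprime-*ʳ c c)) n²∣L d∣L
      where
      c : Coprime d n
      c = Coprime.sym (coprime-∣ (parts∣* r₁ r₂) (Coprime.sym (coprime-*ʳ {n = r₁} {r₂}
            (Coprime.sym (coprime-Δ Δ (proj₂ (proj₁ adm)) 1≤d d-smooth))
            (Coprime.sym (coprime-Δ Δ (proj₂ (proj₁ (proj₂ adm))) 1≤d d-smooth)))))

  1≤modulus : 1 ℕ.≤ L
  1≤modulus = 1≤lcm (r₁ ℕ.^ 2 ℕ.* d₁) (r₂ ℕ.^ 2 ℕ.* d₂) (1≤r^2*d r₁ d₁ 1≤r₁ 1≤d₁) (1≤r^2*d r₂ d₂ 1≤r₂ 1≤d₂)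

  1≤parts : 1 ℕ.≤ n
  1≤parts = ℕₚ.n≢0⇒n>0 λ n≡0 → ℕₚ.>⇒≢ 1≤modulus (0∣⇒≡0 (subst (λ n → n ℕ.* n ∣ L) n≡0 n²∣L))

  private
    instance L≢0 = ℕ.>-nonZero 1≤modulus

    n²*d₁≤L : n ℕ.* n ℕ.* d₁ ℕ.≤ L
    n²*d₁≤L = ∣⇒≤ (n²*d∣L 1≤d₁ (proj₂ (proj₁ (proj₂ (proj₂ adm))))
      (∣-trans (n∣m*n (r₁ ℕ.^ 2)) (m∣lcm[m,n] (r₁ ℕ.^ 2 ℕ.* d₁) _)))

    n²*d₂≤L : n ℕ.* n ℕ.* d₂ ℕ.≤ L
    n²*d₂≤L = ∣⇒≤ (n²*d∣L 1≤d₂ (proj₂ (proj₂ (proj₂ (proj₂ adm))))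
      (∣-trans (n∣m*n (r₂ ℕ.^ 2)) (n∣lcm[m,n] (r₁ ℕ.^ 2 ℕ.* d₁) (r₂ ℕ.^ 2 ℕ.* d₂))))

  d₁≤modulus : d₁ ℕ.≤ L
  d₁≤modulus = ℕₚ.≤-trans (ℕₚ.m≤n*m d₁ (n ℕ.* n) {{ℕ.>-nonZero (ℕₚ.*-mono-≤ 1≤parts 1≤parts)}}) n²*d₁≤L

  d₂≤modulus : d₂ ℕ.≤ L
  d₂≤modulus = ℕₚ.≤-trans (ℕₚ.m≤n*m d₂ (n ℕ.* n) {{ℕ.>-nonZero (ℕₚ.*-mono-≤ 1≤parts 1≤parts)}}) n²*d₂≤L

  parts≤modulus : n ℕ.≤ L
  parts≤modulus = ℕₚ.≤-trans (ℕₚ.m≤m*n n n {{ℕ.>-nonZero 1≤parts}}) (∣⇒≤ n²∣L)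

  parts≤ : ∀ {s} → 0ℚ ≤ s → ι L ≤ s * s → ι n ≤ s * (weight d₁ * weight d₂)
  parts≤ {s} 0≤s L≤s² = ⁴-cancel-≤ (0≤* 0≤s (0≤* (0≤weight d₁) (0≤weight d₂))) (begin
    ι n ⁴
      ≡⟨ ℚₚ.*-identityʳ (ι n ⁴) ⟨
    ι n ⁴ * (1ℚ * 1ℚ)
      ≤⟨ *-monoˡ (ι n ⁴) (0≤x⁴ (ι n)) (*-mono (≤-const _ _) (ℚₚ.≤-trans (≤-const _ _) (1≤weight⁴*n d₁ 1≤d₁))
           (1≤weight⁴*n d₁ 1≤d₁) (1≤weight⁴*n d₂ 1≤d₂)) ⟩
    ι n ⁴ * ((weight d₁ ⁴ * ι d₁) * (weight d₂ ⁴ * ι d₂))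
      ≡⟨ regroup (ι n) (weight d₁) (weight d₂) (ι d₁) (ι d₂) ⟩
    ((ι n * ι n * ι d₁) * (ι n * ι n * ι d₂)) * (weight d₁ * weight d₂) ⁴
      ≤⟨ *-monoʳ _ (0≤x⁴ (weight d₁ * weight d₂))
           (*-mono (0≤ι² d₂) (ℚₚ.≤-trans (0≤ι² d₁) (le d₁ n²*d₁≤L)) (le d₁ n²*d₁≤L) (le d₂ n²*d₂≤L)) ⟩
    s ⁴ * (weight d₁ * weight d₂) ⁴
      ≡⟨ ⁴-* s (weight d₁ * weight d₂) ⟨
    (s * (weight d₁ * weight d₂)) ⁴ ∎)
    where
    0≤ι² : ∀ d → 0ℚ ≤ ι n * ι n * ι d
    0≤ι² d = 0≤* (0≤* (0≤ι n) (0≤ι n)) (0≤ι d)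
    le : ∀ d → n ℕ.* n ℕ.* d ℕ.≤ L → ι n * ι n * ι d ≤ s * s
    le d h = subst (_≤ s * s) (trans (ι-* (n ℕ.* n) d) (cong (_* ι d) (ι-* n n))) (ℚₚ.≤-trans (ι-mono h) L≤s²)
    regroup : ∀ n u v x y → n ⁴ * ((u ⁴ * x) * (v ⁴ * y)) ≡ ((n * n * x) * (n * n * y)) * (u * v) ⁴
    regroup = solve 5 (λ n u v x y →
      f n :* ((f u :* x) :* (f v :* y)) := ((n :* n :* x) :* (n :* n :* y)) :* f (u :* v)) refl
      where f = λ x → (x :* x) :* (x :* x)

harmonic : ℕ → ℚ
harmonic M = Σℚ (λ i → 1/ι (suc i)) (downFrom M)

0≤harmonic : ∀ M → 0ℚ ≤ harmonic M
0≤harmonic M = 0≤Σℚ (λ i → 0≤1/ι (suc i)) (downFrom M)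

-- For fixed cofactors a, b and fixed d₁, d₂ the tuple is determined by g = gcd r₁ r₂, and
-- g ≤ s w(d₁) w(d₂) / (a b).
count-admissible : ∀ {Δ} → Δ ≢ 0ℤ → ∀ {M s} → 0ℚ ≤ s → ι M ≤ s * s →
  Count≤ (λ t → Admissible Δ t × modulus t ℕ.≤ M)
         (s * (harmonic M * (harmonic M * (ι 8 ^ ℤ.∣ Δ ∣ * ι 8 ^ ℤ.∣ Δ ∣))))
count-admissible {Δ} Δ≢0 {M} {s} 0≤s M≤s² =
  Count≤-mono (λ t → t) (ℚₚ.≤-trans (ℚₚ.≤-reflexive (Σℚ-*ˡ s bound box)) (*-monoˡ s 0≤s Σ-bound≤))
    (Count≤-fibres (≡-dec ℕₚ._≟_ (≡-dec ℕₚ._≟_ (≡-dec ℕₚ._≟_ ℕₚ._≟_))) key (λ k → s * bound k) box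
      key∈box (λ k → Count≤-injection g (0≤* 0≤s (0≤bound k)) g-range g-injective))
  where
  D = ℤ.∣ Δ ∣
  S = smooth D M

  g : Tuple → ℕ
  g (r₁ , r₂ , _ , _) = gcd r₁ r₂

  key : Tuple → Tuple
  key (r₁ , r₂ , d₁ , d₂) = pred (cofactor₁ r₁ r₂) , pred (cofactor₂ r₁ r₂) , d₁ , d₂

  bound : Tuple → ℚ
  bound (i , j , d₁ , d₂) = 1/ι (suc i) * (1/ι (suc j) * (weight d₁ * weight d₂))

  0≤bound : ∀ k → 0ℚ ≤ bound k
  0≤bound (i , j , d₁ , d₂) = 0≤* (0≤1/ι (suc i)) (0≤* (0≤1/ι (suc j)) (0≤* (0≤weight d₁) (0≤weight d₂)))

  box : List Tuple
  box = cartesianProduct (downFrom M) (cartesianProduct (downFrom M) (cartesianProduct S S))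

  Σ-bound≤ : Σℚ bound box ≤ harmonic M * (harmonic M * (ι 8 ^ D * ι 8 ^ D))
  Σ-bound≤ = ℚₚ.≤-trans
    (Σℚ-cartesianProductWith {u = λ i → 1/ι (suc i)} {v = λ (j , d₁ , d₂) → 1/ι (suc j) * (weight d₁ * weight d₂)}
       _,_ (λ _ _ → ℚₚ.≤-refl) (downFrom M) _)
    (*-monoˡ (harmonic M) (0≤harmonic M) (ℚₚ.≤-trans
      (Σℚ-cartesianProductWith {u = λ j → 1/ι (suc j)} {v = λ (d₁ , d₂) → weight d₁ * weight d₂}
         _,_ (λ _ _ → ℚₚ.≤-refl) (downFrom M) _)
      (*-monoˡ (harmonic M) (0≤harmonic M) (ℚₚ.≤-trans
        (Σℚ-cartesianProductWith {u = weight} {v = weight} _,_ (λ _ _ → ℚₚ.≤-refl) S S)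
        (*-mono (0≤Σℚ 0≤weight S) (0≤^ (0≤ι 8) D) (Σ-weight-smooth D M) (Σ-weight-smooth D M))))))

  1≤cofactors : (t@(r₁ , r₂ , _) : Tuple) → Admissible Δ t →
    1 ℕ.≤ cofactor₁ r₁ r₂ × 1 ℕ.≤ cofactor₂ r₁ r₂ × 1 ℕ.≤ gcd r₁ r₂
  1≤cofactors t@(r₁ , r₂ , _) adm =
    let 1≤ab , 1≤g = 1≤* (cofactor₁ r₁ r₂ ℕ.* cofactor₂ r₁ r₂) (gcd r₁ r₂) (1≤parts Δ t adm)
        1≤a , 1≤b = 1≤* (cofactor₁ r₁ r₂) (cofactor₂ r₁ r₂) 1≤ab
    in 1≤a , 1≤b , 1≤g

  suc-pred : ∀ {n} → 1 ℕ.≤ n → suc (pred n) ≡ n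
  suc-pred (s≤s _) = refl

  key∈box : ∀ {t} → Admissible Δ t × modulus t ℕ.≤ M → key t ∈ box
  key∈box {t@(r₁ , r₂ , d₁ , d₂)} (adm , L≤M) =
    let 1≤a , 1≤b , 1≤g = 1≤cofactors t adm
        n≤M = ℕₚ.≤-trans (parts≤modulus Δ t adm) L≤M
        ab≤M = ℕₚ.≤-trans (ℕₚ.m≤m*n (a ℕ.* b) (gcd r₁ r₂) {{ℕ.>-nonZero 1≤g}}) n≤M
        a≤M = ℕₚ.≤-trans (ℕₚ.m≤m*n a b {{ℕ.>-nonZero 1≤b}}) ab≤M
        b≤M = ℕₚ.≤-trans (ℕₚ.m≤n*m b a {{ℕ.>-nonZero 1≤a}}) ab≤M
        _ , _ , (1≤d₁ , smooth₁) , (1≤d₂ , smooth₂) = adm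
    in ∈-cartesianProduct⁺ (∈-downFrom⁺ (subst (ℕ._≤ M) (sym (suc-pred 1≤a)) a≤M))
      (∈-cartesianProduct⁺ (∈-downFrom⁺ (subst (ℕ._≤ M) (sym (suc-pred 1≤b)) b≤M))
      (∈-cartesianProduct⁺ (∈S 1≤d₁ (ℕₚ.≤-trans (d₁≤modulus Δ t adm) L≤M) smooth₁)
                           (∈S 1≤d₂ (ℕₚ.≤-trans (d₂≤modulus Δ t adm) L≤M) smooth₂)))
    where
    a = cofactor₁ r₁ r₂
    b = cofactor₂ r₁ r₂
    instance
      D≢0 : ℕ.NonZero D
      D≢0 = ℕ.≢-nonZero (Δ≢0 ∘ ℤₚ.∣i∣≡0⇒i≡0)
    ∈S : ∀ {d} → 1 ℕ.≤ d → d ℕ.≤ M → (∀ q → Prime q → q ∣ d → (+ q) ∣ᶻ Δ) → d ∈ S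
    ∈S 1≤d d≤M d-smooth = ∈-smooth D 1≤d d≤M λ q pr q∣d → ℕₚ.m≤n⇒m≤1+n (∣⇒≤ (d-smooth q pr q∣d))

  g-range : ∀ {k t} → (Admissible Δ t × modulus t ℕ.≤ M) × key t ≡ k →
    1 ℕ.≤ g t × ι (g t) ≤ s * bound k
  g-range {t = t@(r₁ , r₂ , d₁ , d₂)} ((adm , L≤M) , refl) =
    let 1≤a , 1≤b , 1≤g = 1≤cofactors t adm in 1≤g , divide 1≤a 1≤b
    where
    a = cofactor₁ r₁ r₂
    b = cofactor₂ r₁ r₂
    w = weight d₁ * weight d₂
    a⁻¹ = 1/ι (suc (pred a))
    b⁻¹ = 1/ι (suc (pred b))
    divide : 1 ℕ.≤ a → 1 ℕ.≤ b → ι (gcd r₁ r₂) ≤ s * (a⁻¹ * (b⁻¹ * w))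
    divide 1≤a 1≤b = begin
      ι (g t)
        ≡⟨ solve 1 (λ g → g := con 1ℚ :* (con 1ℚ :* g)) refl (ι (g t)) ⟩
      1ℚ * (1ℚ * ι (g t))
        ≡⟨ cong₂ (λ x y → x * (y * ι (g t))) (inv 1≤a) (inv 1≤b) ⟨
      (ι a * a⁻¹) * ((ι b * b⁻¹) * ι (g t))
        ≡⟨ solve 5 (λ a a′ b b′ g → (a :* a′) :* ((b :* b′) :* g) := (a :* b :* g) :* (a′ :* b′)) refl
             (ι a) a⁻¹ (ι b) b⁻¹ (ι (g t)) ⟩
      ι a * ι b * ι (g t) * (a⁻¹ * b⁻¹)
        ≡⟨ cong (_* (a⁻¹ * b⁻¹)) (trans (ι-* (a ℕ.* b) (g t)) (cong (_* ι (g t)) (ι-* a b))) ⟨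
      ι (parts r₁ r₂) * (a⁻¹ * b⁻¹)
        ≤⟨ *-monoʳ (a⁻¹ * b⁻¹) (0≤* (0≤1/ι (suc (pred a))) (0≤1/ι (suc (pred b))))
             (parts≤ Δ t adm 0≤s (ℚₚ.≤-trans (ι-mono L≤M) M≤s²)) ⟩
      (s * w) * (a⁻¹ * b⁻¹)
        ≡⟨ solve 4 (λ s w a b → (s :* w) :* (a :* b) := s :* (a :* (b :* w))) refl s w a⁻¹ b⁻¹ ⟩
      s * (a⁻¹ * (b⁻¹ * w)) ∎
      where
      inv : ∀ {n} → 1 ℕ.≤ n → ι n * 1/ι (suc (pred n)) ≡ 1ℚ
      inv {suc n} _ = ι*1/ι (suc n)

  g-injective : ∀ {k t u} → (Admissible Δ t × modulus t ℕ.≤ M) × key t ≡ k →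
    (Admissible Δ u × modulus u ℕ.≤ M) × key u ≡ k → g t ≡ g u → t ≡ u
  g-injective {t = t@(r₁ , r₂ , d₁ , d₂)} {u@(r₁′ , r₂′ , d₁′ , d₂′)} ((adm , _) , refl) ((adm′ , _) , key≡) g≡ =
    let 1≤a , 1≤b , _ = 1≤cofactors t adm
        1≤a′ , 1≤b′ , _ = 1≤cofactors u adm′
        a≡ = trans (sym (suc-pred 1≤a)) (trans (cong (suc ∘ proj₁) (sym key≡)) (suc-pred 1≤a′))
        b≡ = trans (sym (suc-pred 1≤b)) (trans (cong (suc ∘ proj₁ ∘ proj₂) (sym key≡)) (suc-pred 1≤b′))
    in cong₂ _,_ (trans (cofactor₁-* r₁ r₂) (trans (cong₂ ℕ._*_ a≡ g≡) (sym (cofactor₁-* r₁′ r₂′))))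
      (cong₂ _,_ (trans (cofactor₂-* r₁ r₂) (trans (cong₂ ℕ._*_ b≡ g≡) (sym (cofactor₂-* r₁′ r₂′))))
        (cong (proj₂ ∘ proj₂) (sym key≡)))

-- The exponential series

1/! : ℕ → ℚ
1/! n = 1/ι (n !) {{n ℕₚ.!≢0}}

0≤1/! : ∀ n → 0ℚ ≤ 1/! n
0≤1/! n = 0≤1/ι (n !) {{n ℕₚ.!≢0}}

1/!-suc : ∀ n → ι (suc n) * 1/! (suc n) ≡ 1/! n
1/!-suc n = begin-equality
  ι (suc n) * 1/! (suc n)
    ≡⟨ solve 2 (λ a b → a :* b := a :* b :* con 1ℚ) refl (ι (suc n)) (1/! (suc n)) ⟩
  ι (suc n) * 1/! (suc n) * 1ℚ
    ≡⟨ cong (ι (suc n) * 1/! (suc n) *_) (ι*1/ι (n !) {{n ℕₚ.!≢0}}) ⟨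
  ι (suc n) * 1/! (suc n) * (ι (n !) * 1/! n)
    ≡⟨ solve 4 (λ a b c d → a :* b :* (c :* d) := (a :* c) :* b :* d) refl (ι (suc n)) (1/! (suc n)) (ι (n !)) (1/! n) ⟩
  (ι (suc n) * ι (n !)) * 1/! (suc n) * 1/! n
    ≡⟨ cong (λ x → x * 1/! (suc n) * 1/! n) (ι-* (suc n) (n !)) ⟨
  ι (suc n !) * 1/! (suc n) * 1/! n
    ≡⟨ cong (_* 1/! n) (ι*1/ι (suc n !) {{suc n ℕₚ.!≢0}}) ⟩
  1ℚ * 1/! n
    ≡⟨ ℚₚ.*-identityˡ (1/! n) ⟩
  1/! n ∎

E : ℕ → ℚ → ℚ
E zero    y = 1ℚ
E (suc n) y = E n y + 1/! (suc n) * y ^ suc n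

seq-^ᴿ : ∀ x n m → seq (x ^ᴿ n) m ≡ seq x m ^ n
seq-^ᴿ x zero    m = refl
seq-^ᴿ x (suc n) m = cong (seq x m *_) (seq-^ᴿ x n m)

seq-expSum : ∀ x n m → seq (expSum x n) m ≡ E n (seq x m)
seq-expSum x zero    m = refl
seq-expSum x (suc n) m = cong₂ (λ a b → a + 1/! (suc n) * b) (seq-expSum x n m) (seq-^ᴿ x (suc n) m)

^-mono : ∀ {x y} n → 0ℚ ≤ x → x ≤ y → x ^ n ≤ y ^ n
^-mono zero    0≤x x≤y = ℚₚ.≤-refl
^-mono (suc n) 0≤x x≤y = *-mono (0≤^ 0≤x n) (ℚₚ.≤-trans 0≤x x≤y) x≤y (^-mono n 0≤x x≤y)

E-mono : ∀ n {x y} → 0ℚ ≤ x → x ≤ y → E n x ≤ E n y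
E-mono zero    0≤x x≤y = ℚₚ.≤-refl
E-mono (suc n) 0≤x x≤y =
  ℚₚ.+-mono-≤ (E-mono n 0≤x x≤y) (*-monoˡ (1/! (suc n)) (0≤1/! (suc n)) (^-mono (suc n) 0≤x x≤y))

E-0 : ∀ n → E n 0ℚ ≡ 1ℚ
E-0 zero    = refl
E-0 (suc n) = trans (cong₂ _+_ (E-0 n)
  (trans (cong (1/! (suc n) *_) (ℚₚ.*-zeroˡ (0ℚ ^ n))) (ℚₚ.*-zeroʳ (1/! (suc n))))) refl

^-mean-value : ∀ k {y h} → 0ℚ ≤ y → 0ℚ ≤ h → (y + h) ^ suc k ≤ y ^ suc k + ι (suc k) * (h * (y + h) ^ k)
^-mean-value zero    {y} {h} 0≤y 0≤h = ℚₚ.≤-reflexive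
  (solve 2 (λ y h → (y :+ h) :* con 1ℚ := y :* con 1ℚ :+ con 1ℚ :* (h :* con 1ℚ)) refl y h)
^-mean-value (suc k) {y} {h} 0≤y 0≤h = begin
  z * z ^ suc k
    ≡⟨ ℚₚ.*-distribʳ-+ (z ^ suc k) y h ⟩
  y * z ^ suc k + h * z ^ suc k
    ≤⟨ ℚₚ.+-monoˡ-≤ (h * z ^ suc k) (*-monoˡ y 0≤y (^-mean-value k 0≤y 0≤h)) ⟩
  y * (y ^ suc k + ι (suc k) * (h * z ^ k)) + h * z ^ suc k
    ≡⟨ solve 6 (λ y h Y m Z ZZ → y :* (Y :+ m :* (h :* Z)) :+ h :* ZZ := (y :* Y :+ m :* h :* (y :* Z)) :+ h :* ZZ)
         refl y h (y ^ suc k) (ι (suc k)) (z ^ k) (z ^ suc k) ⟩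
  (y * y ^ suc k + ι (suc k) * h * (y * z ^ k)) + h * z ^ suc k
    ≤⟨ ℚₚ.+-monoˡ-≤ (h * z ^ suc k) (ℚₚ.+-monoʳ-≤ (y ^ suc (suc k)) (*-monoˡ (ι (suc k) * h) (0≤* (0≤ι (suc k)) 0≤h)
         (*-monoʳ (z ^ k) (0≤^ 0≤z k) y≤z))) ⟩
  (y ^ suc (suc k) + ι (suc k) * h * (z * z ^ k)) + h * z ^ suc k
    ≡⟨ solve 4 (λ Y m h Z → (Y :+ m :* h :* Z) :+ h :* Z := Y :+ (con 1ℚ :+ m) :* (h :* Z))
         refl (y ^ suc (suc k)) (ι (suc k)) h (z ^ suc k) ⟩
  y ^ suc (suc k) + (1ℚ + ι (suc k)) * (h * z ^ suc k)
    ≡⟨ cong (λ m → y ^ suc (suc k) + m * (h * z ^ suc k)) (ι-suc (suc k)) ⟨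
  y ^ suc (suc k) + ι (suc (suc k)) * (h * z ^ suc k) ∎
  where
  z = y + h
  0≤z : 0ℚ ≤ z
  0≤z = 0≤+ 0≤y 0≤h
  y≤z : y ≤ z
  y≤z = 0≤q-p⇒p≤q (solve 2 (λ y h → (y :+ h) :- y := h) refl y h) 0≤h

E-mean-value : ∀ n {y h} → 0ℚ ≤ y → 0ℚ ≤ h → E (suc n) (y + h) ≤ E (suc n) y + h * E n (y + h)
E-mean-value zero    {y} {h} 0≤y 0≤h = ℚₚ.≤-reflexive
  (solve 2 (λ y h → con 1ℚ :+ con 1ℚ :* ((y :+ h) :* con 1ℚ) := con 1ℚ :+ con 1ℚ :* (y :* con 1ℚ) :+ h :* con 1ℚ) refl y h)
E-mean-value (suc n) {y} {h} 0≤y 0≤h = begin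
  E (suc n) z + c * z ^ suc (suc n)
    ≤⟨ ℚₚ.+-mono-≤ (E-mean-value n 0≤y 0≤h) (*-monoˡ c (0≤1/! (suc (suc n))) (^-mean-value (suc n) 0≤y 0≤h)) ⟩
  (E (suc n) y + h * E n z) + c * (y ^ suc (suc n) + ι (suc (suc n)) * (h * z ^ suc n))
    ≡⟨ solve 7 (λ e h f c Y m Z → (e :+ h :* f) :+ c :* (Y :+ m :* (h :* Z)) := (e :+ c :* Y) :+ h :* (f :+ (m :* c) :* Z))
         refl (E (suc n) y) h (E n z) c (y ^ suc (suc n)) (ι (suc (suc n))) (z ^ suc n) ⟩
  E (suc (suc n)) y + h * (E n z + (ι (suc (suc n)) * c) * z ^ suc n)
    ≡⟨ cong (λ d → E (suc (suc n)) y + h * (E n z + d * z ^ suc n)) (1/!-suc (suc n)) ⟩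
  E (suc (suc n)) y + h * E (suc n) z ∎
  where
  z = y + h
  c = 1/! (suc (suc n))

E-≤-suc : ∀ n {y} → 0ℚ ≤ y → E n y ≤ E (suc n) y
E-≤-suc n {y} 0≤y = 0≤q-p⇒p≤q (solve 2 (λ e x → (e :+ x) :- e := x) refl (E n y) (1/! (suc n) * y ^ suc n))
  (0≤* (0≤1/! (suc n)) (0≤^ 0≤y (suc n)))

E-shift : ∀ n {y h} → 0ℚ ≤ y → 0ℚ ≤ h → (1ℚ - h) * E n (y + h) ≤ E n y
E-shift zero    {y} {h} 0≤y 0≤h = 0≤q-p⇒p≤q (solve 1 (λ h → con 1ℚ :- (con 1ℚ :- h) :* con 1ℚ := h) refl h) 0≤h
E-shift (suc n) {y} {h} 0≤y 0≤h = 0≤q-p⇒p≤q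
  (solve 4 (λ e h f g → e :- (con 1ℚ :- h) :* f := (e :+ h :* g :- f) :+ h :* (f :- g))
    refl (E (suc n) y) h (E (suc n) (y + h)) (E n (y + h)))
  (0≤+ (p≤q⇒0≤q-p (E-mean-value n 0≤y 0≤h)) (0≤* 0≤h (p≤q⇒0≤q-p (E-≤-suc n (0≤+ 0≤y 0≤h)))))

¼ : ℚ
¼ = + 1 / 4

1/ι≤1 : ∀ n .{{_ : ℕ.NonZero n}} → 1/ι n ≤ 1ℚ
1/ι≤1 n@(suc m) = subst₂ _≤_ (ℚₚ.*-identityˡ (1/ι n)) (ι*1/ι n) (*-monoʳ (1/ι n) (0≤1/ι n) (ι-mono {1} {n} (s≤s z≤n)))

-- The constant ¼ leaves a gap: (M + 3) / 3 < M for M ≥ 2, so that log M > ¼ H_M there.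
E-harmonic : ∀ n M → ι 3 * E n (¼ * harmonic M) ≤ ι M + ι 3
E-harmonic n zero = ℚₚ.≤-reflexive (trans (cong (λ e → ι 3 * e) (trans (cong (E n) (ℚₚ.*-zeroʳ ¼)) (E-0 n))) refl)
E-harmonic n (suc M) = ℚₚ.*-cancelˡ-≤-pos (1ℚ - h) {{ℚ.positive 0<1-h}} (begin
  (1ℚ - h) * (ι 3 * E n (¼ * (u + H)))
    ≡⟨ cong (λ x → (1ℚ - h) * (ι 3 * E n x)) (solve 2 (λ u H → con ¼ :* (u :+ H) := con ¼ :* H :+ con ¼ :* u) refl u H) ⟩
  (1ℚ - h) * (ι 3 * E n (¼ * H + h))
    ≡⟨ solve 3 (λ a b e → a :* (b :* e) := b :* (a :* e)) refl (1ℚ - h) (ι 3) (E n (¼ * H + h)) ⟩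
  ι 3 * ((1ℚ - h) * E n (¼ * H + h))
    ≤⟨ *-monoˡ (ι 3) (0≤ι 3) (E-shift n (0≤* (≤-const 0ℚ ¼) (0≤harmonic M)) 0≤h) ⟩
  ι 3 * E n (¼ * H)
    ≤⟨ E-harmonic n M ⟩
  ι M + ι 3
    ≤⟨ 0≤q-p⇒p≤q diff (0≤* (≤-const 0ℚ (+ 3 / 4)) (p≤q⇒0≤q-p (1/ι≤1 (suc M)))) ⟩
  (1ℚ - h) * (ι (suc M) + ι 3) ∎)
  where
  u = 1/ι (suc M)
  h = ¼ * u
  H = harmonic M
  0≤h : 0ℚ ≤ h
  0≤h = 0≤* (≤-const 0ℚ ¼) (0≤1/ι (suc M))
  0<1-h : 0ℚ < 1ℚ - h
  0<1-h = ℚₚ.<-≤-trans (ℚₚ.positive⁻¹ (+ 3 / 4)) (0≤q-p⇒p≤q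
    (solve 1 (λ u → (con 1ℚ :- con ¼ :* u) :- con (+ 3 / 4) := con ¼ :* (con 1ℚ :- u)) refl u)
    (0≤* (≤-const 0ℚ ¼) (p≤q⇒0≤q-p (1/ι≤1 (suc M)))))
  diff : (1ℚ - h) * (ι (suc M) + ι 3) - (ι M + ι 3) ≡ (+ 3 / 4) * (1ℚ - u)
  diff = trans (cong (λ m → (1ℚ - h) * (m + ι 3) - (ι M + ι 3)) (ι-suc M))
    (trans (solve 2 (λ u m → (con 1ℚ :- con ¼ :* u) :* ((con 1ℚ :+ m) :+ con (ι 3)) :- (m :+ con (ι 3))
              := con 1ℚ :- con ¼ :* ((con 1ℚ :+ m) :* u) :- con (+ 3 / 4) :* u) refl u (ι M))
    (trans (cong (λ x → 1ℚ - ¼ * x - (+ 3 / 4) * u) (trans (cong (_* u) (sym (ι-suc M))) (ι*1/ι (suc M))))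
      (solve 1 (λ u → con 1ℚ :- con ¼ :* con 1ℚ :- con (+ 3 / 4) :* u := con (+ 3 / 4) :* (con 1ℚ :- u)) refl u)))

-- (y - h)ᵏ⁺¹ = yᵏ⁺¹ - (k + 1) h yᵏ + h² R k y (y - h), and likewise T for the exponential sums.
R : ℕ → ℚ → ℚ → ℚ
R zero    y u = 0ℚ
R (suc k) y u = u * R k y u + ι (suc k) * y ^ k

^-taylor : ∀ k y h → (y - h) ^ suc k ≡ y ^ suc k - ι (suc k) * (h * y ^ k) + h * h * R k y (y - h)
^-taylor zero y h = solve 2 (λ y h → (y :- h) :* con 1ℚ
  := y :* con 1ℚ :- con 1ℚ :* (h :* con 1ℚ) :+ h :* h :* con 0ℚ) refl y h
^-taylor (suc k) y h = begin-equality
  u * u ^ suc k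
    ≡⟨ cong (u *_) (^-taylor k y h) ⟩
  u * (y * Y - m * (h * Y) + h * h * r)
    ≡⟨ solve 5 (λ y h Y m r → (y :- h) :* (y :* Y :- m :* (h :* Y) :+ h :* h :* r) :=
         y :* (y :* Y) :- (con 1ℚ :+ m) :* (h :* (y :* Y)) :+ h :* h :* ((y :- h) :* r :+ m :* Y)) refl y h Y m r ⟩
  y * (y * Y) - (1ℚ + m) * (h * (y * Y)) + h * h * (u * r + m * Y)
    ≡⟨ cong (λ x → y * (y * Y) - x * (h * (y * Y)) + h * h * (u * r + m * Y)) (ι-suc (suc k)) ⟨
  y ^ suc (suc k) - ι (suc (suc k)) * (h * y ^ suc k) + h * h * R (suc k) y u ∎
  where
  u = y - h
  Y = y ^ k
  m = ι (suc k)
  r = R k y u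

T : ℕ → ℚ → ℚ → ℚ
T zero    y u = 0ℚ
T (suc n) y u = T n y u + 1/! (suc (suc n)) * R (suc n) y u

E-taylor : ∀ n y h → E (suc n) (y - h) ≡ E (suc n) y - h * E n y + h * h * T n y (y - h)
E-taylor zero y h = solve 2 (λ y h → con 1ℚ :+ con 1ℚ :* ((y :- h) :* con 1ℚ)
  := con 1ℚ :+ con 1ℚ :* (y :* con 1ℚ) :- h :* con 1ℚ :+ h :* h :* con 0ℚ) refl y h
E-taylor (suc n) y h = begin-equality
  E (suc n) u + c * u ^ suc (suc n)
    ≡⟨ cong₂ (λ a b → a + c * b) (E-taylor n y h) (^-taylor (suc n) y h) ⟩
  (E (suc n) y - h * E n y + h * h * T n y u) + c * (y ^ suc (suc n) - m * (h * y ^ suc n) + h * h * R (suc n) y u)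
    ≡⟨ solve 9 (λ e h f t c Y m Z r → (e :- h :* f :+ h :* h :* t) :+ c :* (Y :- m :* (h :* Z) :+ h :* h :* r)
         := (e :+ c :* Y) :- h :* (f :+ (m :* c) :* Z) :+ h :* h :* (t :+ c :* r))
         refl (E (suc n) y) h (E n y) (T n y u) c (y ^ suc (suc n)) m (y ^ suc n) (R (suc n) y u) ⟩
  E (suc (suc n)) y - h * (E n y + (m * c) * y ^ suc n) + h * h * T (suc n) y u
    ≡⟨ cong (λ d → E (suc (suc n)) y - h * (E n y + d * y ^ suc n) + h * h * T (suc n) y u) (1/!-suc (suc n)) ⟩
  E (suc (suc n)) y - h * E (suc n) y + h * h * T (suc n) y u ∎
  where
  u = y - h
  c = 1/! (suc (suc n))
  m = ι (suc (suc n))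

p≤∣p∣ : ∀ p → p ≤ ∣ p ∣
p≤∣p∣ p with ℚₚ.≤-total 0ℚ p
... | inj₁ 0≤p = ℚₚ.≤-reflexive (sym (ℚₚ.0≤p⇒∣p∣≡p 0≤p))
... | inj₂ p≤0 = ℚₚ.≤-trans p≤0 (ℚₚ.0≤∣p∣ p)

∣∣-*-≤ : ∀ {p q a b} → ∣ p ∣ ≤ a → ∣ q ∣ ≤ b → ∣ p * q ∣ ≤ a * b
∣∣-*-≤ {p} {q} {a} p≤a q≤b = subst (_≤ a * _) (sym (ℚₚ.∣p*q∣≡∣p∣*∣q∣ p q))
  (*-mono (ℚₚ.0≤∣p∣ q) (ℚₚ.≤-trans (ℚₚ.0≤∣p∣ p) p≤a) p≤a q≤b)

∣∣-+-≤ : ∀ {p q a b} → ∣ p ∣ ≤ a → ∣ q ∣ ≤ b → ∣ p + q ∣ ≤ a + b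
∣∣-+-≤ {p} {q} p≤a q≤b = ℚₚ.≤-trans (ℚₚ.∣p+q∣≤∣p∣+∣q∣ p q) (ℚₚ.+-mono-≤ p≤a q≤b)

∣∣-*ˡ-≤ : ∀ {p q b} → 0ℚ ≤ p → ∣ q ∣ ≤ b → ∣ p * q ∣ ≤ p * b
∣∣-*ˡ-≤ 0≤p q≤b = ∣∣-*-≤ (ℚₚ.≤-reflexive (ℚₚ.0≤p⇒∣p∣≡p 0≤p)) q≤b

module _ {B y u : ℚ} (y≤B : ∣ y ∣ ≤ B) (u≤B : ∣ u ∣ ≤ B) where
  ∣^∣≤ : ∀ k → ∣ y ^ k ∣ ≤ B ^ k
  ∣^∣≤ zero    = ≤-const _ _
  ∣^∣≤ (suc k) = ∣∣-*-≤ y≤B (∣^∣≤ k)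

  ∣R∣≤ : ∀ k → ∣ R k y u ∣ ≤ R k B B
  ∣R∣≤ zero    = ≤-const _ _
  ∣R∣≤ (suc k) = ∣∣-+-≤ (∣∣-*-≤ u≤B (∣R∣≤ k)) (∣∣-*ˡ-≤ (0≤ι (suc k)) (∣^∣≤ k))

  ∣T∣≤ : ∀ n → ∣ T n y u ∣ ≤ T n B B
  ∣T∣≤ zero    = ≤-const _ _
  ∣T∣≤ (suc n) = ∣∣-+-≤ (∣T∣≤ n) (∣∣-*ˡ-≤ (0≤1/! (suc (suc n))) (∣R∣≤ (suc n)))

-- For y ≤ 0 the last term of a sum F of odd degree is non-positive, so F ≤ F′ and a step of length
-- h to the left gives F (y - h) ≤ (1 - h) F y + O(h²).  After J steps of length t / J from 0, the
-- total error is O(1/J), hence F (- t) ≤ 1.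
module _ (k : ℕ) where
  private
    n = k ℕ.+ k
    F = E (suc n)

  E-odd-≤ : ∀ {y} → y ≤ 0ℚ → F y ≤ E n y
  E-odd-≤ {y} y≤0 = 0≤q-p⇒p≤q
    (solve 4 (λ e c y z → e :- (e :+ c :* (y :* z)) := c :* ((con 0ℚ :- y) :* z)) refl (E n y) (1/! (suc n)) y (y ^ n))
    (0≤* (0≤1/! (suc n)) (0≤* (p≤q⇒0≤q-p y≤0) (subst (0ℚ ≤_) (sym (^-+ y k k)) (0≤p² (y ^ k)))))

  E-odd-step : ∀ {B y h} → y ≤ 0ℚ → 0ℚ ≤ h → ∣ y ∣ ≤ B → ∣ y - h ∣ ≤ B →
    F (y - h) ≤ (1ℚ - h) * F y + h * h * T n B B
  E-odd-step {B} {y} {h} y≤0 0≤h y≤B u≤B = begin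
    F (y - h)                                ≡⟨ E-taylor n y h ⟩
    F y - h * E n y + h * h * T n y (y - h)  ≤⟨ ℚₚ.+-mono-≤
        (0≤q-p⇒p≤q {F y - h * E n y} {(1ℚ - h) * F y}
          (solve 3 (λ f h e → (con 1ℚ :- h) :* f :- (f :- h :* e) := h :* (e :- f)) refl (F y) h (E n y))
          (0≤* 0≤h (p≤q⇒0≤q-p (E-odd-≤ y≤0))))
        (*-monoˡ (h * h) (0≤p² h) (ℚₚ.≤-trans (p≤∣p∣ (T n y (y - h))) (∣T∣≤ y≤B u≤B n))) ⟩
    (1ℚ - h) * F y + h * h * T n B B ∎

  E-odd-steps : ∀ {B h} → 0ℚ ≤ T n B B → 0ℚ ≤ h → h ≤ 1ℚ → ∀ j → ι j * h ≤ B →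
    F (0ℚ - ι j * h) ≤ 1ℚ + ι j * (h * h * T n B B)
  E-odd-steps {B} {h} 0≤C 0≤h h≤1 zero jh≤B = ℚₚ.≤-reflexive (trans (cong F (trans
    (cong (λ x → 0ℚ - x) (ℚₚ.*-zeroˡ h)) refl)) (trans (E-0 (suc n))
      (solve 1 (λ c → con 1ℚ := con 1ℚ :+ con 0ℚ :* c) refl (h * h * T n B B))))
  E-odd-steps {B} {h} 0≤C 0≤h h≤1 (suc j) jh≤B = begin
    F (0ℚ - ι (suc j) * h)
      ≡⟨ cong F next ⟩
    F (y - h)
      ≤⟨ E-odd-step (0≤q-p⇒p≤q (solve 1 (λ x → con 0ℚ :- (con 0ℚ :- x) := x) refl (ι j * h)) 0≤jh) 0≤h
           (abs (ι j * h) 0≤jh jh≤B′) (subst (λ x → ∣ x ∣ ≤ B) next (abs (ι (suc j) * h) (0≤* (0≤ι (suc j)) 0≤h) jh≤B)) ⟩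
    (1ℚ - h) * F y + h * h * C
      ≤⟨ ℚₚ.+-monoˡ-≤ (h * h * C) (*-monoˡ (1ℚ - h) (p≤q⇒0≤q-p h≤1) (E-odd-steps 0≤C 0≤h h≤1 j jh≤B′)) ⟩
    (1ℚ - h) * (1ℚ + ι j * D) + D
      ≤⟨ 0≤q-p⇒p≤q (trans (cong (λ m → 1ℚ + m * D - ((1ℚ - h) * (1ℚ + ι j * D) + D)) (ι-suc j))
           (solve 3 (λ m h d → (con 1ℚ :+ (con 1ℚ :+ m) :* d) :- ((con 1ℚ :- h) :* (con 1ℚ :+ m :* d) :+ d)
              := h :* (con 1ℚ :+ m :* d)) refl (ι j) h D))
           (0≤* 0≤h (0≤+ (≤-const 0ℚ 1ℚ) (0≤* (0≤ι j) (0≤* (0≤p² h) 0≤C)))) ⟩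
    1ℚ + ι (suc j) * (h * h * C) ∎
    where
    C = T n B B
    D = h * h * C
    y = 0ℚ - ι j * h
    0≤jh : 0ℚ ≤ ι j * h
    0≤jh = 0≤* (0≤ι j) 0≤h
    next : 0ℚ - ι (suc j) * h ≡ y - h
    next = trans (cong (λ m → 0ℚ - m * h) (ι-suc j))
      (solve 2 (λ m h → con 0ℚ :- (con 1ℚ :+ m) :* h := (con 0ℚ :- m :* h) :- h) refl (ι j) h)
    jh≤B′ : ι j * h ≤ B
    jh≤B′ = ℚₚ.≤-trans (*-monoʳ h 0≤h (ι-mono (ℕₚ.n≤1+n j))) jh≤B
    abs : ∀ x → 0ℚ ≤ x → x ≤ B → ∣ 0ℚ - x ∣ ≤ B
    abs x 0≤x x≤B = subst (_≤ B) (sym (trans (cong ∣_∣ (ℚₚ.+-identityˡ (- x)))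
      (trans (ℚₚ.∣-p∣≡∣p∣ x) (ℚₚ.0≤p⇒∣p∣≡p 0≤x)))) x≤B

bounded-multiples⇒≤0 : ∀ {p q} m → (∀ n → m ℕ.≤ n → ι n * p ≤ q) → p ≤ 0ℚ
bounded-multiples⇒≤0 {p} {q} m np≤q with p ℚₚ.≤? 0ℚ
... | yes p≤0 = p≤0
... | no p≰0 = 0≤q-p⇒p≤q {r = (ι n * p) - (1ℚ + ι n) * p}
  (solve 2 (λ n p → con 0ℚ :- p := n :* p :- (con 1ℚ :+ n) :* p) refl (ι n) p) (p≤q⇒0≤q-p (begin
    (1ℚ + ι n) * p       ≡⟨ cong (_* p) (ι-suc n) ⟨
    ι (suc n) * p        ≤⟨ np≤q (suc n) (ℕₚ.m≤n⇒m≤1+n (ℕₚ.m≤n+m m k)) ⟩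
    q                    ≡⟨ ℚₚ.*-identityʳ q ⟨
    q * 1ℚ               ≡⟨ cong (q *_) (ℚₚ.*-inverseˡ p) ⟨
    q * (1/ p * p)       ≡⟨ ℚₚ.*-assoc q (1/ p) p ⟨
    q * 1/ p * p         ≤⟨ *-monoʳ p 0≤p (proj₂ (archimedean (q * 1/ p))) ⟩
    ι k * p              ≤⟨ *-monoʳ p 0≤p (ι-mono (ℕₚ.m≤m+n k m)) ⟩
    ι n * p ∎))
  where
  instance
    posp = ℚ.positive (ℚₚ.≰⇒> p≰0)
    nzp = ℚₚ.pos⇒nonZero p
  0≤p = ℚₚ.<⇒≤ (ℚₚ.≰⇒> p≰0)
  k = proj₁ (archimedean (q * 1/ p))
  n = k ℕ.+ m

E-odd≤1 : ∀ k {y} → y ≤ 0ℚ → E (suc (k ℕ.+ k)) y ≤ 1ℚ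
E-odd≤1 k {y} y≤0 = 0≤q-p⇒p≤q (solve 1 (λ f → con 1ℚ :- f := con 0ℚ :- (f :- con 1ℚ)) refl (F y))
  (p≤q⇒0≤q-p (bounded-multiples⇒≤0 {q = t * t * C} (suc (proj₁ (archimedean t))) multiples))
  where
  n = k ℕ.+ k
  F = E (suc n)
  t = 0ℚ - y
  C = T n t t
  0≤t : 0ℚ ≤ t
  0≤t = p≤q⇒0≤q-p y≤0
  ∣t∣≤t : ∣ t ∣ ≤ t
  ∣t∣≤t = ℚₚ.≤-reflexive (ℚₚ.0≤p⇒∣p∣≡p 0≤t)
  0≤C : 0ℚ ≤ C
  0≤C = ℚₚ.≤-trans (ℚₚ.0≤∣p∣ C) (∣T∣≤ ∣t∣≤t ∣t∣≤t n)
  multiples : ∀ J → suc (proj₁ (archimedean t)) ℕ.≤ J → ι J * (F y - 1ℚ) ≤ t * t * C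
  multiples J@(suc j) (s≤s t≤j) = begin
    ι J * (F y - 1ℚ)
      ≤⟨ *-monoˡ (ι J) (0≤ι J) (0≤q-p⇒p≤q
           (solve 2 (λ x f → x :- (f :- con 1ℚ) := (con 1ℚ :+ x) :- f) refl (ι J * (h * h * C)) (F y))
           (p≤q⇒0≤q-p (subst (λ x → F x ≤ 1ℚ + ι J * (h * h * C)) y≡
             (E-odd-steps k 0≤C 0≤h h≤1 J (ℚₚ.≤-reflexive Jh≡t))))) ⟩
    ι J * (ι J * (h * h * C))
      ≡⟨ solve 3 (λ J h C → J :* (J :* (h :* h :* C)) := (J :* h) :* (J :* h) :* C) refl (ι J) h C ⟩
    (ι J * h) * (ι J * h) * C
      ≡⟨ cong (λ x → x * x * C) Jh≡t ⟩
    t * t * C ∎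
    where
    v = 1/ι J
    h = t * v
    0≤h : 0ℚ ≤ h
    0≤h = 0≤* 0≤t (0≤1/ι J)
    h≤1 : h ≤ 1ℚ
    h≤1 = subst (h ≤_) (ι*1/ι J) (*-monoʳ v (0≤1/ι J)
      (ℚₚ.≤-trans (proj₂ (archimedean t)) (ι-mono (ℕₚ.m≤n⇒m≤1+n t≤j))))
    Jh≡t : ι J * h ≡ t
    Jh≡t = trans (solve 3 (λ J t v → J :* (t :* v) := t :* (J :* v)) refl (ι J) t v)
      (trans (cong (t *_) (ι*1/ι J)) (ℚₚ.*-identityʳ t))
    y≡ : 0ℚ - ι J * h ≡ y
    y≡ = trans (cong (λ x → 0ℚ - x) Jh≡t) (solve 1 (λ y → con 0ℚ :- (con 0ℚ :- y) := y) refl y)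

harmonic≤4log : ∀ k {M y} → 2 ℕ.≤ M → ι M - ¼ ≤ E (suc (k ℕ.+ k)) y → harmonic M ≤ ι 4 * y
harmonic≤4log k {M} {y} 2≤M M≤E with harmonic M ℚₚ.≤? ι 4 * y | ℚₚ.≤-total y 0ℚ
... | yes H≤ | _ = H≤
... | no _   | inj₁ y≤0 = contradiction
  (ℚₚ.≤-trans (ℚₚ.+-monoˡ-≤ (- ¼) (ι-mono 2≤M)) (ℚₚ.≤-trans M≤E (E-odd≤1 k y≤0)))
  (≰-const (ι 2 - ¼) 1ℚ)
... | no H≰  | inj₂ 0≤y = contradiction
  (subst (0ℚ ≤_)
    (solve 1 (λ m → (m :+ con (ι 3) :- con (ι 3) :* (m :- con ¼)) :+ con (ι 2) :* (m :- con (ι 2))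
      := con (- ¼)) refl (ι M))
    (0≤+ (p≤q⇒0≤q-p 3M≤) (0≤* (0≤ι 2) (p≤q⇒0≤q-p (ι-mono 2≤M)))))
  (≰-const 0ℚ (- ¼))
  where
  N = suc (k ℕ.+ k)
  y≤H/4 : y ≤ ¼ * harmonic M
  y≤H/4 = 0≤q-p⇒p≤q (solve 2 (λ y H → con ¼ :* H :- y := con ¼ :* (H :- con (ι 4) :* y)) refl y (harmonic M))
    (0≤* (≤-const 0ℚ ¼) (p≤q⇒0≤q-p (ℚₚ.<⇒≤ (ℚₚ.≰⇒> H≰))))
  3M≤ : ι 3 * (ι M - ¼) ≤ ι M + ι 3
  3M≤ = begin
    ι 3 * (ι M - ¼)            ≤⟨ *-monoˡ (ι 3) (0≤ι 3) (ℚₚ.≤-trans M≤E (E-mono N 0≤y y≤H/4)) ⟩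
    ι 3 * E N (¼ * harmonic M) ≤⟨ E-harmonic N M ⟩
    ι M + ι 3                  ∎

-- Real bounds

Eventually : (ℕ → Set) → Set
Eventually P = ∃[ N ] (∀ n → N ℕ.≤ n → P n)

eventually-zip : ∀ {P Q R : ℕ → Set} → (∀ n → P n → Q n → R n) → Eventually P → Eventually Q → Eventually R
eventually-zip f (M , p) (N , q) =
  M ℕ.⊔ N , λ n le → f n (p n (ℕₚ.m⊔n≤o⇒m≤o M N le)) (q n (ℕₚ.m⊔n≤o⇒n≤o M N le))

eventually-≤⇒≤ᴿ : ∀ {x y} → Eventually (λ n → seq x n ≤ seq y n) → x ≤ᴿ y
eventually-≤⇒≤ᴿ {y = y} (N , x≤y) ε 0<ε = N , λ n le → ℚₚ.≤-trans (x≤y n le)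
  (subst (_≤ seq y n + ε) (ℚₚ.+-identityʳ (seq y n)) (ℚₚ.+-monoʳ-≤ (seq y n) (ℚₚ.<⇒≤ 0<ε)))

sqrt-eventually-≥0 : ∀ {s x} → fromℕ 0 <ᴿ x → IsSqrt s x → Eventually (λ n → 0ℚ ≤ seq s n)
sqrt-eventually-≥0 {s} {x} (ε , 0<ε , 0<x) (0≤s , _ , x≤s²) =
  eventually-zip (λ n (0≤sₙ , xₙ≤) 0<xₙ → go (seq s n) (seq x n) 0<xₙ 0≤sₙ xₙ≤)
    (eventually-zip (λ _ → _,_) (0≤s δ 0<δ) (x≤s² δ 0<δ)) 0<x
  where
  e = ε ℚ.⊓ 1ℚ
  δ = ½ * e
  0<e : 0ℚ < e
  0<e with ℚₚ.⊓-sel ε 1ℚ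
  ... | inj₁ eq = subst (0ℚ <_) (sym eq) 0<ε
  ... | inj₂ eq = subst (0ℚ <_) (sym eq) (ℚₚ.positive⁻¹ 1ℚ)
  0<δ : 0ℚ < δ
  0<δ = subst (_< δ) (ℚₚ.*-zeroʳ ½) (ℚₚ.*-monoʳ-<-pos ½ 0<e)
  δ≤½ : δ ≤ ½
  δ≤½ = *-monoˡ ½ (≤-const 0ℚ ½) (ℚₚ.p⊓q≤q ε 1ℚ)
  go : ∀ sₙ xₙ → 0ℚ + ε ≤ xₙ → 0ℚ ≤ sₙ + δ → xₙ ≤ sₙ * sₙ + δ → 0ℚ ≤ sₙ
  go sₙ xₙ ε≤xₙ 0≤sₙ+δ xₙ≤ with ℚₚ.≤-total 0ℚ sₙ
  ... | inj₁ 0≤sₙ = 0≤sₙ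
  ... | inj₂ sₙ≤0 = contradiction (ℚₚ.<-≤-trans 0<δ δ≤0) (ℚₚ.<-irrefl refl)
    where
    t = 0ℚ - sₙ
    t≤δ : t ≤ δ
    t≤δ = 0≤q-p⇒p≤q (solve 2 (λ d s → d :- (con 0ℚ :- s) := s :+ d) refl δ sₙ) 0≤sₙ+δ
    e≤ : e ≤ ½ * δ + δ
    e≤ = begin
      e            ≤⟨ ℚₚ.p⊓q≤p ε 1ℚ ⟩
      ε            ≡⟨ ℚₚ.+-identityˡ ε ⟨
      0ℚ + ε       ≤⟨ ε≤xₙ ⟩
      xₙ           ≤⟨ xₙ≤ ⟩
      sₙ * sₙ + δ  ≡⟨ solve 2 (λ s d → s :* s :+ d := (con 0ℚ :- s) :* (con 0ℚ :- s) :+ d) refl sₙ δ ⟩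
      t * t + δ    ≤⟨ ℚₚ.+-monoˡ-≤ δ (*-mono (p≤q⇒0≤q-p sₙ≤0) (≤-const 0ℚ ½) (ℚₚ.≤-trans t≤δ δ≤½) t≤δ) ⟩
      ½ * δ + δ ∎
    δ≤0 : δ ≤ 0ℚ
    δ≤0 = 0≤q-p⇒p≤q (solve 1 (λ e → con 0ℚ :- con ½ :* e :=
        con (ι 2) :* ((con ½ :* (con ½ :* e) :+ con ½ :* e) :- e)) refl e)
      (0≤* (0≤ι 2) (p≤q⇒0≤q-p e≤))

log-eventually : ∀ {l x M} → 2 ℕ.≤ M → fromℕ M ≤ᴿ x → IsLog l x →
  Eventually (λ n → harmonic M ≤ ι 4 * seq l n)
log-eventually {l} {x} {M} 2≤M M≤x log =
  eventually-zip (λ n M≤xₙ xₙ≤E → harmonic≤4log N₀ {M} 2≤M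
      (0≤q-p⇒p≤q (solve 3 (λ M x e → e :- (M :- con ¼)
          := (x :+ con δ :- M) :+ (e :+ con δ :+ con δ :- x)) refl (ι M) (seq x n) (E N (seq l n)))
        (0≤+ (p≤q⇒0≤q-p M≤xₙ)
             (p≤q⇒0≤q-p (subst (λ e → seq x n ≤ e + δ + δ) (seq-expSum l N n) xₙ≤E)))))
    (M≤x δ 0<δ) (proj₂ (proj₂ (log δ 0<δ) N (ℕₚ.m≤n⇒m≤1+n (ℕₚ.m≤m+n N₀ N₀))) δ 0<δ)
  where
  δ = + 1 / 12
  0<δ : 0ℚ < δ
  0<δ = ℚₚ.positive⁻¹ δ
  N₀ = proj₁ (log δ 0<δ)
  N = suc (N₀ ℕ.+ N₀)

-- The factor 2 absorbs the approximation errors, because M ≥ 2.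
sqrt-eventually : ∀ {s x M} → 2 ℕ.≤ M → fromℕ M ≤ᴿ x → IsSqrt s x →
  Eventually (λ n → ι M ≤ (ι 2 * seq s n) * (ι 2 * seq s n))
sqrt-eventually {s} {x} {M} 2≤M M≤x (_ , _ , x≤s²) =
  eventually-zip (λ n M≤xₙ xₙ≤s² →
      0≤q-p⇒p≤q (solve 3 (λ M x s → (con (ι 2) :* s) :* (con (ι 2) :* s) :- M :=
           con (ι 4) :* ((x :+ con ½ :- M) :+ (s :* s :+ con ½ :- x)) :+ (con (ι 3) :* (M :- con (ι 2)) :+ con (ι 2)))
           refl (ι M) (seq x n) (seq s n))
        (0≤+ (0≤* (0≤ι 4) (0≤+ (p≤q⇒0≤q-p M≤xₙ) (p≤q⇒0≤q-p xₙ≤s²)))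
             (0≤+ (0≤* (0≤ι 3) (p≤q⇒0≤q-p (ι-mono 2≤M))) (0≤ι 2))))
    (M≤x ½ 0<½) (x≤s² ½ 0<½)
  where
  0<½ : 0ℚ < ½
  0<½ = ℚₚ.positive⁻¹ ½

range⇒admissible : ∀ {Δ X} (t : Tuple) → Range Δ X t → Admissible Δ t × fromℕ (modulus t) ≤ᴿ X
range⇒admissible _ (c₁ , c₂ , c₃ , c₄ , L≤X) = (c₁ , c₂ , c₃ , c₄) , L≤X

range-<1 : ∀ {Δ X} (t : Tuple) → X <ᴿ fromℕ 1 → ¬ Range Δ X t
range-<1 {Δ} {X} t (ε , 0<ε , X<1) r = contradiction (ℚₚ.<-≤-trans 0<½ε ½ε≤0) (ℚₚ.<-irrefl refl)
  where
  adm = range⇒admissible {Δ} {X} t r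
  0<½ε : 0ℚ < ½ * ε
  0<½ε = subst (_< ½ * ε) (ℚₚ.*-zeroʳ ½) (ℚₚ.*-monoʳ-<-pos ½ 0<ε)
  close : Eventually (λ _ → ½ * ε ≤ 0ℚ)
  close = eventually-zip (λ n L≤Xₙ Xₙ<1 → 0≤q-p⇒p≤q
      (solve 2 (λ x e → con 0ℚ :- con ½ :* e := (con 1ℚ :- (x :+ e)) :+ (x :+ con ½ :* e :- con 1ℚ)) refl (seq X n) ε)
      (0≤+ (p≤q⇒0≤q-p Xₙ<1) (p≤q⇒0≤q-p (ℚₚ.≤-trans (ι-mono (1≤modulus Δ t (proj₁ adm))) L≤Xₙ))))
    (proj₂ adm (½ * ε) 0<½ε) X<1
  ½ε≤0 : ½ * ε ≤ 0ℚ
  ½ε≤0 = proj₂ close (proj₁ close) ℕₚ.≤-refl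

range-bound : ∀ {Δ X ts} → fromℕ 2 ≤ᴿ X → All (Range Δ X) ts →
  ∃[ M ] (2 ℕ.≤ M × fromℕ M ≤ᴿ X × All (λ t → Admissible Δ t × modulus t ℕ.≤ M) ts)
range-bound 2≤X [] = 2 , ℕₚ.≤-refl , 2≤X , []
range-bound {Δ} {X} {t ∷ _} 2≤X (r ∷ rs)
  with adm , L≤X ← range⇒admissible {Δ} {X} t r
  with M , 2≤M , M≤X , adms ← range-bound {Δ} {X} 2≤X rs
  with ℕₚ.≤-total (modulus t) M
... | inj₁ L≤M = M , 2≤M , M≤X , (adm , L≤M) ∷ adms
... | inj₂ M≤L = modulus t , ℕₚ.≤-trans 2≤M M≤L , L≤X ,
                 (adm , ℕₚ.≤-refl) ∷ All.map (λ (a , le) → a , ℕₚ.≤-trans le M≤L) adms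

lemma4p3 : (Δ : ℤ) → Δ ≢ 0ℤ →
    ∃[ c ] (∀ (X : ℝ) → fromℕ 0 <ᴿ X → X <ᴿ fromℕ 1 ⊎ fromℕ 2 ≤ᴿ X →
    ∀ (√X logX : ℝ) → IsSqrt √X X → IsLog logX X →
    Sum1≤ (Range Δ X) (c *ᴿ √X *ᴿ logX ^ᴿ 2))
lemma4p3 Δ Δ≢0 = fromℚ c , λ X 0<X X<1⊎2≤X √X logX sqrt log ts uts ats →
  eventually-≤⇒≤ᴿ {fromℕ (length ts)} {fromℚ c *ᴿ √X *ᴿ logX ^ᴿ 2}
    (bound X 0<X X<1⊎2≤X √X logX sqrt log ts uts ats)
  where
  V = ι 8 ^ ℤ.∣ Δ ∣
  W = V * V
  0≤W : 0ℚ ≤ W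
  0≤W = 0≤p² V
  c = ι 32 * W

  bound : ∀ X → fromℕ 0 <ᴿ X → X <ᴿ fromℕ 1 ⊎ fromℕ 2 ≤ᴿ X → ∀ √X logX → IsSqrt √X X → IsLog logX X →
    ∀ ts → Unique ts → All (Range Δ X) ts →
    Eventually (λ n → ι (length ts) ≤ c * seq √X n * (seq logX n * (seq logX n * 1ℚ)))
  bound X 0<X (inj₁ X<1) √X logX sqrt log (t ∷ _) uts (r ∷ _) = contradiction r (range-<1 {Δ} {X} t X<1)
  bound X 0<X (inj₁ X<1) √X logX sqrt log [] uts [] =
    eventually-zip (λ n 0≤s _ → 0≤* (0≤* (0≤* (0≤ι 32) 0≤W) 0≤s)
        (subst (λ x → 0ℚ ≤ seq logX n * x) (sym (ℚₚ.*-identityʳ (seq logX n))) (0≤p² (seq logX n))))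
      0≤√X 0≤√X
    where 0≤√X = sqrt-eventually-≥0 {√X} {X} 0<X sqrt
  bound X 0<X (inj₂ 2≤X) √X logX sqrt log ts uts ats =
    let M , 2≤M , M≤X , adms = range-bound {Δ} {X} 2≤X ats in
    eventually-zip (λ n (0≤s , M≤) H≤ → count M (seq √X n) (seq logX n) 0≤s M≤ H≤ adms)
      (eventually-zip (λ _ → _,_) (sqrt-eventually-≥0 {√X} {X} 0<X sqrt) (sqrt-eventually {√X} {X} 2≤M M≤X sqrt))
      (log-eventually {logX} {X} 2≤M M≤X log)
    where
    count : ∀ M s l → 0ℚ ≤ s → ι M ≤ (ι 2 * s) * (ι 2 * s) → harmonic M ≤ ι 4 * l →
      All (λ t → Admissible Δ t × modulus t ℕ.≤ M) ts → ι (length ts) ≤ c * s * (l * (l * 1ℚ))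
    count M s l 0≤s M≤ H≤ adms = begin
      ι (length ts)
        ≤⟨ count-admissible Δ≢0 (0≤* (0≤ι 2) 0≤s) M≤ ts uts adms ⟩
      ι 2 * s * (harmonic M * (harmonic M * W))
        ≤⟨ *-monoˡ (ι 2 * s) (0≤* (0≤ι 2) 0≤s) (*-mono (0≤* (0≤harmonic M) 0≤W) (ℚₚ.≤-trans (0≤harmonic M) H≤)
             H≤ (*-monoʳ W 0≤W H≤)) ⟩
      ι 2 * s * (ι 4 * l * (ι 4 * l * W))
        ≡⟨ solve 3 (λ s l w → con (ι 2) :* s :* (con (ι 4) :* l :* (con (ι 4) :* l :* w))
             := con (ι 32) :* w :* s :* (l :* (l :* con 1ℚ))) refl s l W ⟩
      c * s * (l * (l * 1ℚ)) ∎
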